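{- Let $G$ be a connected finite simple graph with at least two vertices and no induced subgraph isomorphic to the path $P_4$ on four vertices. Then $G$ has a spanning subgraph that is an SBEP graph if and only if $\tau(G)\ge \frac{1}{2}$.
   Context: A simple block EP (SBEP) graph is a connected graph $H$ such that (i) each block of $H$ is either an even cycle or a single edge, and (ii) each vertex of $H$ lies in at most two blocks. For $S \subseteq V(G)$, $G-S$ is the subgraph induced on $V(G)-S$ and $c(H)$ is the number of components of $H$. For real $t\ge0$, $G$ is $t$-tough if $|S|\ge t\cdot c(G-S)$ for every $S\subseteq V(G)$ with $c(G-S)\ge 2$. The toughness $\tau(G)$ is the largest $t$ for which $G$ is $t$-tough, or $\infty$ if $G$ is complete. -}

module Defs where

open import Data.Nat using (ℕ; zero; suc; _+_; _*_; _≤_; _∸_)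
open import Data.Fin using (Fin; toℕ)
open import Data.Fin.Subset using (Subset; ∣_∣)
open import Data.Vec using (lookup)
open import Data.Bool using (Bool; true; false; not; T; _∧_)
open import Data.Product using (Σ; ∃; _×_; _,_)
open import Data.Sum using (_⊎_)
open import Relation.Binary.PropositionalEquality using (_≡_; _≢_)
open import Relation.Nullary using (¬_)
open import Function.Bundles using (_⇔_)

record Graph (n : ℕ) : Set where
  field
    adj   : Fin n → Fin n → Bool
    sym   : ∀ u v → adj u v ≡ adj v u
    irr   : ∀ v → adj v v ≡ false
open Graph public

record SubG (n : ℕ) : Set where
  constructor mkSubG
  field
    V : Fin n → Bool
    E : Fin n → Fin n → Bool
open SubG public

WF : ∀ {n} → SubG n → Set
WF B = (∀ u v → E B u v ≡ E B v u) × (∀ v → E B v v ≡ false)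
     × (∀ u v → T (E B u v) → T (V B u) × T (V B v))

_⊑_ : ∀ {n} → SubG n → SubG n → Set
B ⊑ B' = (∀ v → T (V B v) → T (V B' v)) × (∀ u v → T (E B u v) → T (E B' u v))

Distinct : ∀ {n} → SubG n → SubG n → Set
Distinct B B' = (∃ λ v → V B v ≢ V B' v) ⊎ (∃ λ u → ∃ λ v → E B u v ≢ E B' u v)

data Reach {n : ℕ} (B : SubG n) : Fin n → Fin n → Set where
  here : ∀ {v} → T (V B v) → Reach B v v
  step : ∀ {u w v} → T (V B u) → T (E B u w) → Reach B w v → Reach B u v

Connected : ∀ {n} → SubG n → Set
Connected B = ∀ u v → T (V B u) → T (V B v) → Reach B u v

Nonempty : ∀ {n} → SubG n → Set
Nonempty B = ∃ λ v → T (V B v)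

_-v_ : ∀ {n} → SubG n → Fin n → SubG n
_-v_ {n} B x = mkSubG (λ v → V B v ∧ not (eqF v x)) (λ u v → E B u v ∧ not (eqF u x) ∧ not (eqF v x))
  where
  eqF : Fin n → Fin n → Bool
  eqF a b = Data.Nat._≡ᵇ_ (toℕ a) (toℕ b)

Nonseparable : ∀ {n} → SubG n → Set
Nonseparable B = Nonempty B × Connected B × (∀ x → T (V B x) → Connected (B -v x))

IsBlock : ∀ {n} → SubG n → SubG n → Set
IsBlock {n} H B = WF B × B ⊑ H × Nonseparable B
  × (∀ (B' : SubG n) → WF B' → B' ⊑ H → Nonseparable B' → B ⊑ B' → B' ⊑ B)

CycAdj : (k : ℕ) → Fin k → Fin k → Set
CycAdj k i j = (toℕ j ≡ suc (toℕ i)) ⊎ ((toℕ i ≡ k ∸ 1) × (toℕ j ≡ 0))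

Injective : ∀ {k n} → (Fin k → Fin n) → Set
Injective f = ∀ i j → f i ≡ f j → i ≡ j

IsEvenCycle : ∀ {n} → SubG n → Set
IsEvenCycle {n} B = ∃ λ (m : ℕ) → Σ (Fin (2 * (2 + m)) → Fin n) λ f →
    Injective f
  × (∀ v → T (V B v) ⇔ (∃ λ i → f i ≡ v))
  × (∀ u v → T (E B u v) ⇔ (∃ λ i → ∃ λ j → CycAdj (2 * (2 + m)) i j
                             × ((f i ≡ u × f j ≡ v) ⊎ (f i ≡ v × f j ≡ u))))

IsSingleEdge : ∀ {n} → SubG n → Set
IsSingleEdge B = ∃ λ a → ∃ λ b → a ≢ b
  × (∀ v → T (V B v) ⇔ (v ≡ a ⊎ v ≡ b))
  × (∀ u v → T (E B u v) ⇔ ((u ≡ a × v ≡ b) ⊎ (u ≡ b × v ≡ a)))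

IsSBEP : ∀ {n} → SubG n → Set
IsSBEP {n} H = Connected H
  × (∀ B → IsBlock H B → IsEvenCycle B ⊎ IsSingleEdge B)
  × (∀ v B₁ B₂ B₃ → IsBlock H B₁ → IsBlock H B₂ → IsBlock H B₃
       → T (V B₁ v) → T (V B₂ v) → T (V B₃ v)
       → Distinct B₁ B₂ → Distinct B₁ B₃ → Distinct B₂ B₃ → ⊥')
  where open import Data.Empty renaming (⊥ to ⊥')

full : ∀ {n} → Graph n → SubG n
full G = mkSubG (λ _ → true) (adj G)

HasSpanningSBEP : ∀ {n} → Graph n → Set
HasSpanningSBEP {n} G = Σ (SubG n) λ H →
  WF H × (∀ v → T (V H v)) × H ⊑ full G × IsSBEP H

_⊖_ : ∀ {n} → Graph n → Subset n → SubG n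
G ⊖ S = mkSubG (λ v → not (lookup S v)) (λ u v → adj G u v ∧ not (lookup S u) ∧ not (lookup S v))

HasComponents : ∀ {n} → SubG n → ℕ → Set
HasComponents {n} B k = Σ (Fin n → Fin k) λ f →
    (∀ i → ∃ λ v → T (V B v) × f v ≡ i)
  × (∀ u v → T (V B u) → T (V B v) → (f u ≡ f v ⇔ Reach B u v))

-- G is t-tough for t = p/q (q > 0): q|S| ≥ p c(G-S) whenever c(G-S) ≥ 2
IsTough : ∀ {n} → Graph n → (p q : ℕ) → Set
IsTough G p q = ∀ S k → HasComponents (G ⊖ S) k → 2 ≤ k → p * k ≤ q * ∣ S ∣

-- τ(G) ≥ 1/2  (toughness is a maximum over finitely many constraints, so this
-- is equivalent to G being 1/2-tough; complete graphs satisfy it vacuously)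
ToughnessAtLeastHalf : ∀ {n} → Graph n → Set
ToughnessAtLeastHalf G = IsTough G 1 2

GraphConnected : ∀ {n} → Graph n → Set
GraphConnected G = Connected (full G)

HasInducedP4 : ∀ {n} → Graph n → Set
HasInducedP4 G = ∃ λ a → ∃ λ b → ∃ λ c → ∃ λ d →
    (a ≢ b × a ≢ c × a ≢ d × b ≢ c × b ≢ d × c ≢ d)
  × (adj G a b ≡ true × adj G b c ≡ true × adj G c d ≡ true)
  × (adj G a c ≡ false × adj G a d ≡ false × adj G b d ≡ false)

-- Toughness of an SBEP graph H: orient every block cyclically.  If S ≠ ∅, every component of
-- H − S contains the successor, in some block B, of some s ∈ S ∩ B, and the pair (s, B)
-- determines the component; each s lies in at most two blocks, so there are at most 2|S| of them.
--
-- Conversely, decompose the P₄-free graph G into unions and joins.  A piece is a path with an odd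
-- number of vertices each of which may carry one further block with more pieces hanging from it.
-- If all ends of the pieces P, Q, R are adjacent to a, then P a Q is a piece, and R together with
-- a is a single edge or an even cycle that can be hung at a, so a reduces the number of pieces by
-- one or two.  By induction every cograph X can be partitioned into m pieces whenever
-- d(X) ≤ m ≤ |X|, where d(X) = max_S (c(X − S) − 2|S|).  A connected G is a join of A and B with
-- |A| ≤ |B|, and toughness gives d(B) ≤ 2|A|; then all but one vertex of A merge the pieces of B
-- into one or two, which the last vertex of A closes up to blocks.
module Submission where

open import Defs
open import Data.Nat using (ℕ; zero; suc; _+_; _*_; _∸_; _⊔_; _≤_; _<_; z≤n; s≤s; _≡ᵇ_)
import Data.Nat.Properties as ℕ
open import Data.Nat.Solver using (module +-*-Solver)
open import Data.Bool as Bool using (Bool; true; false; not; T; _∧_; if_then_else_)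
import Data.Bool.Properties as Bool
open import Data.Fin as Fin using (Fin; zero; suc; toℕ; fromℕ; inject₁; combine; #_)
open import Data.Fin.Induction using (<-weakInduction; <-weakInduction-startingFrom)
import Data.Fin.Properties as Fin
open import Data.Fin.Subset using (Subset; ∣_∣)
import Data.Fin.Subset.Properties as Subset
open import Data.Vec as Vec using ([]; _∷_)
import Data.Vec.Properties as Vec
open import Data.List as List using (List; []; _∷_; _++_; [_]; length; filter; concat)
import Data.List.Properties as List
open import Data.List.Membership.Propositional using (_∈_; _∉_; find; lose)
open import Data.List.Membership.Propositional.Properties
open import Data.List.Relation.Binary.Permutation.Propositional
open import Data.List.Relation.Binary.Permutation.Propositional.Properties as Perm
  using (↭-length; ∈-resp-↭; ++-commutativeMonoid)
open import Data.List.Relation.Unary.All as All using (All; []; _∷_)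
import Data.List.Relation.Unary.All.Properties as All
open import Data.List.Relation.Unary.AllPairs using (AllPairs; []; _∷_)
import Data.List.Relation.Unary.AllPairs.Properties as AllPairs
open import Data.List.Relation.Unary.Any as Any using (Any; here; there; any?)
open import Data.List.Relation.Unary.Any.Properties using (lookup-index)
open import Data.List.Relation.Unary.Linked using (Linked; [-]; _∷_)
open import Data.List.Relation.Unary.Unique.Propositional using (Unique)
open import Data.List.Relation.Unary.Unique.Propositional.Properties using (allFin⁺)
open import Data.Empty using (⊥; ⊥-elim)
open import Data.Product using (Σ; ∃; ∃₂; _×_; _,_; proj₁; proj₂)
open import Data.Sum as Sum using (_⊎_; inj₁; inj₂)
open import Data.Unit using (tt)
open import Function using (_∘_; Equivalence; mk⇔)
open import Function.Bundles using (_⇔_)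
open import Relation.Binary using (tri<; tri≈; tri>)
open import Relation.Binary.PropositionalEquality as ≡ using (_≡_; _≢_; refl; cong; cong₂; subst)
open import Relation.Nullary using (¬_; Dec; yes; no; contradiction)
open import Relation.Nullary.Decidable as Dec
  using (decidable-stable; ¬¬-excluded-middle; ¬?; _×-dec_; _⊎-dec_; ⌊_⌋; toWitness; fromWitness)
open Equivalence using (to; from)

-- The factor 2 in `d` is the most that one vertex can save: it links two pieces and closes a third
-- below itself. The odd length of a piece survives linking (odd + 1 + odd) and makes the closing
-- cycle even. A vertex of the smaller side can be used only while the piece ends it meets lie in
-- the larger side. A linking vertex becomes interior and preserves this, whereas a vertex with a
-- piece hung on it becomes an end itself, so hanging comes last. The induction needs the whole
-- range of `m`, since a join has to choose how many pieces of its larger side to start from. As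
-- blocks are maximal nonseparable subgraphs, it also has to be shown that the glued graph has no
-- blocks besides the intended cycles and edges; this rests on gluing at single vertices, which
-- separate what is glued there.

T-∧⁺ : ∀ {a b} → T a → T b → T (a ∧ b)
T-∧⁺ {true} {true} _ _ = tt

T-∧⁻ : ∀ a {b} → T (a ∧ b) → T a × T b
T-∧⁻ true p = tt , p

T? : ∀ b → Dec (T b)
T? true = yes tt
T? false = no λ ()

T-ext : ∀ {a b} → (T a → T b) → (T b → T a) → a ≡ b
T-ext {false} {false} _ _ = refl
T-ext {false} {true} _ g = ⊥-elim (g tt)
T-ext {true} {false} f _ = ⊥-elim (f tt)
T-ext {true} {true} _ _ = refl

T⇒≡true : ∀ {b} → T b → b ≡ true
T⇒≡true {true} _ = refl

≡true⇒T : ∀ {b} → b ≡ true → T b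
≡true⇒T refl = tt

T-not⁻ : ∀ {b} → T (not b) → ¬ T b
T-not⁻ {true} ()

T-not⁺ : ∀ {b} → ¬ T b → T (not b)
T-not⁺ {false} _ = tt
T-not⁺ {true} p = ⊥-elim (p tt)

-- Reachability and inclusion of subgraphs

module _ {n : ℕ} where

  reach-head : ∀ {B : SubG n} {u v} → Reach B u v → T (V B u)
  reach-head (here p) = p
  reach-head (step p _ _) = p

  reach-trans : ∀ {B : SubG n} {u v w} → Reach B u v → Reach B v w → Reach B u w
  reach-trans (here _) s = s
  reach-trans (step p e r) s = step p e (reach-trans r s)

  reach-sym : ∀ {B : SubG n} → (∀ u v → T (E B u v) → T (E B v u)) →
              ∀ {u v} → Reach B u v → Reach B v u
  reach-sym E-sym (here p) = here p
  reach-sym E-sym (step p e r) =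
    reach-trans (reach-sym E-sym r) (step (reach-head r) (E-sym _ _ e) (here p))

  reach-map : ∀ {B C : SubG n} → (∀ v → T (V B v) → T (V C v)) →
              (∀ u v → T (V B u) → T (V B v) → T (E B u v) → T (E C u v)) →
              ∀ {u v} → Reach B u v → Reach C u v
  reach-map f g (here p) = here (f _ p)
  reach-map f g (step p e r) = step (f _ p) (g _ _ p (reach-head r) e) (reach-map f g r)

  reach-closed : ∀ {ℓ} {B : SubG n} (P : Fin n → Set ℓ) →
                 (∀ u w → T (V B u) → T (V B w) → T (E B u w) → P u → P w) →
                 ∀ {u v} → Reach B u v → P u → P v
  reach-closed P cl (here _) p = p
  reach-closed P cl (step q e r) p = reach-closed P cl r (cl _ _ q (reach-head r) e p)

  reach-crossing : ∀ {ℓ} {B : SubG n} {P : Fin n → Set ℓ} → (∀ v → Dec (P v)) →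
                   ∀ {u v} → Reach B u v → P u → ¬ P v →
                   ∃₂ λ x y → T (E B x y) × P x × ¬ P y
  reach-crossing P? (here _) p ¬p = contradiction p ¬p
  reach-crossing P? (step {w = w} q e r) p ¬p with P? w
  ... | yes pw = reach-crossing P? r pw ¬p
  ... | no ¬pw = _ , _ , e , p , ¬pw

  ⊑-refl : ∀ {B : SubG n} → B ⊑ B
  ⊑-refl = (λ _ p → p) , (λ _ _ p → p)

  ⊑-trans : ∀ {A B C : SubG n} → A ⊑ B → B ⊑ C → A ⊑ C
  ⊑-trans (f , g) (f′ , g′) = (λ v → f′ v ∘ f v) , (λ u v → g′ u v ∘ g u v)

-- Maximal nonseparable subgraphs are only produced up to double negation, which suffices
-- because the toughness inequality is decidable.

sumF : ∀ {n} → (Fin n → ℕ) → ℕ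
sumF {zero} f = 0
sumF {suc n} f = f zero + sumF (f ∘ suc)

sumF-mono : ∀ {n} {f g : Fin n → ℕ} → (∀ i → f i ≤ g i) → sumF f ≤ sumF g
sumF-mono {zero} le = z≤n
sumF-mono {suc n} le = ℕ.+-mono-≤ (le zero) (sumF-mono (le ∘ suc))

sumF-mono-< : ∀ {n} {f g : Fin n → ℕ} → (∀ i → f i ≤ g i) → ∀ i → f i < g i → sumF f < sumF g
sumF-mono-< le zero lt = ℕ.+-mono-<-≤ lt (sumF-mono (le ∘ suc))
sumF-mono-< le (suc i) lt = ℕ.+-mono-≤-< (le zero) (sumF-mono-< (le ∘ suc) i lt)

sumF-bound : ∀ {n} c {f : Fin n → ℕ} → (∀ i → f i ≤ c) → sumF f ≤ n * c
sumF-bound {zero} c le = z≤n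
sumF-bound {suc n} c le = ℕ.+-mono-≤ (le zero) (sumF-bound c (le ∘ suc))

bit : Bool → ℕ
bit true = 1
bit false = 0

bit-mono : ∀ {a b} → (T a → T b) → bit a ≤ bit b
bit-mono {false} f = z≤n
bit-mono {true} {true} f = s≤s z≤n
bit-mono {true} {false} f = ⊥-elim (f tt)

bit-< : ∀ {a b} → ¬ T a → T b → bit a < bit b
bit-< {false} {true} _ _ = s≤s z≤n
bit-< {true} p _ = ⊥-elim (p tt)

bit≤1 : ∀ a → bit a ≤ 1
bit≤1 true = s≤s z≤n
bit≤1 false = z≤n

module _ {n : ℕ} where

  size : SubG n → ℕ
  size B = sumF (λ v → bit (V B v)) + sumF (λ u → sumF (λ v → bit (E B u v)))

  size-bound : (B : SubG n) → size B ≤ n * 1 + n * (n * 1)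
  size-bound B = ℕ.+-mono-≤
    (sumF-bound {n} 1 (λ v → bit≤1 (V B v)))
    (sumF-bound {n} (n * 1) (λ u → sumF-bound {n} 1 (λ v → bit≤1 (E B u v))))

  T-⇒? : ∀ a b → Dec (T a → T b)
  T-⇒? a b with T? b | T? a
  ... | yes p | _ = yes λ _ → p
  ... | no ¬p | yes q = no λ f → ¬p (f q)
  ... | no ¬p | no ¬q = yes λ q → contradiction q ¬q

  ¬T-⇒ : ∀ a b → ¬ (T a → T b) → ¬ T b × T a
  ¬T-⇒ a b h = (λ q → h (λ _ → q)) , decidable-stable (T? a) (λ ¬a → h (λ a → contradiction a ¬a))

  size-mono-< : ∀ {B C : SubG n} → B ⊑ C → ¬ C ⊑ B → size B < size C
  size-mono-< {B} {C} (f , g) C⋢B with Fin.all? (λ v → T-⇒? (V C v) (V B v))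
  ... | no ¬all with Fin.¬∀⟶∃¬ n _ (λ v → T-⇒? (V C v) (V B v)) ¬all
  ... | v , ¬p = ℕ.+-mono-<-≤
      (sumF-mono-< (λ v → bit-mono (f v)) v (let q , q′ = ¬T-⇒ _ _ ¬p in bit-< q q′))
      (sumF-mono (λ u → sumF-mono λ v → bit-mono (g u v)))
  size-mono-< {B} {C} (f , g) C⋢B | yes all
    with Fin.all? (λ u → Fin.all? (λ v → T-⇒? (E C u v) (E B u v)))
  ... | yes all₂ = contradiction (all , all₂) C⋢B
  ... | no ¬all with Fin.¬∀⟶∃¬ n _ (λ u → Fin.all? (λ v → T-⇒? (E C u v) (E B u v))) ¬all
  ... | u , ¬p with Fin.¬∀⟶∃¬ n _ (λ v → T-⇒? (E C u v) (E B u v)) ¬p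
  ... | v , ¬q = ℕ.+-mono-≤-<
      (sumF-mono (λ v → bit-mono (f v)))
      (sumF-mono-< (λ u → sumF-mono λ v → bit-mono (g u v)) u
        (sumF-mono-< (λ v → bit-mono (g u v)) v (let q , q′ = ¬T-⇒ _ _ ¬q in bit-< q q′)))

  -- Either nothing nonseparable properly contains `B`, and `B` is a block, or the search moves on
  -- to a larger subgraph. `size` grows strictly and is bounded by `n * 1 + n * (n * 1)`, so `fuel`,
  -- which covers the remaining gap, cannot run out.
  block-above : ∀ {H : SubG n} fuel B → WF B → B ⊑ H → Nonseparable B →
                n * 1 + n * (n * 1) ≤ size B + fuel →
                ¬ ¬ (∃ λ C → IsBlock H C × B ⊑ C)
  block-above {H} fuel B wf B⊑H ns le k = ¬¬-excluded-middle {A = ∃ Bigger} λ where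
      (yes (C , wfC , C⊑H , nsC , B⊑C , C⋢B)) → grow fuel le C wfC C⊑H nsC B⊑C C⋢B
      (no none) → k (B , (wf , B⊑H , ns , λ C wfC C⊑H nsC B⊑C → maximal none C wfC C⊑H nsC B⊑C) , ⊑-refl {B = B})
    where
    Bigger : SubG n → Set
    Bigger C = WF C × C ⊑ H × Nonseparable C × B ⊑ C × ¬ C ⊑ B
    grow : ∀ fuel → n * 1 + n * (n * 1) ≤ size B + fuel →
           ∀ C → WF C → C ⊑ H → Nonseparable C → B ⊑ C → ¬ C ⊑ B → ⊥
    grow zero le C wfC C⊑H nsC B⊑C C⋢B = ℕ.<-irrefl refl
      (ℕ.<-≤-trans (size-mono-< {B} {C} B⊑C C⋢B)
        (ℕ.≤-trans (size-bound C) (subst (n * 1 + n * (n * 1) ≤_) (ℕ.+-identityʳ _) le)))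
    grow (suc fuel) le C wfC C⊑H nsC B⊑C C⋢B =
      block-above {H} fuel C wfC C⊑H nsC
        (ℕ.≤-trans le (ℕ.≤-trans (ℕ.≤-reflexive (ℕ.+-suc (size B) fuel))
          (ℕ.+-monoˡ-≤ fuel (size-mono-< {B} {C} B⊑C C⋢B))))
        (λ (D , blk , C⊑D) → k (D , blk , ⊑-trans {A = B} {C} {D} B⊑C C⊑D))
    maximal : ¬ ∃ Bigger → ∀ C → WF C → C ⊑ H → Nonseparable C → B ⊑ C → C ⊑ B
    maximal none C wfC C⊑H nsC B⊑C =
      (λ v p → decidable-stable (T? _) λ ¬q →
         none (C , wfC , C⊑H , nsC , B⊑C , λ (f , _) → ¬q (f v p))) ,
      (λ u v p → decidable-stable (T? _) λ ¬q →
         none (C , wfC , C⊑H , nsC , B⊑C , λ (_ , g) → ¬q (g u v p)))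

-- Cycles and single edges as cyclic lists

≢⇒T-not-≡ᵇ : ∀ {n} {a b : Fin n} → a ≢ b → T (not (toℕ a ≡ᵇ toℕ b))
≢⇒T-not-≡ᵇ {a = a} {b} a≢b = T-not⁺ (a≢b ∘ Fin.toℕ-injective ∘ ℕ.≡ᵇ⇒≡ (toℕ a) (toℕ b))

T-not-≡ᵇ⇒≢ : ∀ {n} {a b : Fin n} → T (not (toℕ a ≡ᵇ toℕ b)) → a ≢ b
T-not-≡ᵇ⇒≢ {a = a} {b} p a≡b = T-not⁻ p (ℕ.≡⇒≡ᵇ (toℕ a) (toℕ b) (cong toℕ a≡b))

module _ {n : ℕ} (B : SubG n) (x : Fin n) where

  -v-V⁺ : ∀ {v} → T (V B v) → v ≢ x → T (V (B -v x) v)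
  -v-V⁺ p v≢x = T-∧⁺ p (≢⇒T-not-≡ᵇ v≢x)

  -v-V⁻ : ∀ {v} → T (V (B -v x) v) → T (V B v) × v ≢ x
  -v-V⁻ {v} p = let q , r = T-∧⁻ (V B v) p in q , T-not-≡ᵇ⇒≢ r

  -v-E⁺ : ∀ {u v} → T (E B u v) → u ≢ x → v ≢ x → T (E (B -v x) u v)
  -v-E⁺ p u≢x v≢x = T-∧⁺ p (T-∧⁺ (≢⇒T-not-≡ᵇ u≢x) (≢⇒T-not-≡ᵇ v≢x))

  -v-E⁻ : ∀ {u v} → T (E (B -v x) u v) → T (E B u v)
  -v-E⁻ {u} {v} p = proj₁ (T-∧⁻ (E B u v) p)

module _ {A : Set} where

  lookup-injective : ∀ {xs : List A} → Unique xs → ∀ i j → List.lookup xs i ≡ List.lookup xs j → i ≡ j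
  lookup-injective (p ∷ u) zero zero eq = refl
  lookup-injective (p ∷ u) zero (suc j) eq = contradiction eq (All.lookup p (∈-lookup j))
  lookup-injective (p ∷ u) (suc i) zero eq = contradiction (≡.sym eq) (All.lookup p (∈-lookup i))
  lookup-injective (p ∷ u) (suc i) (suc j) eq = cong suc (lookup-injective u i j eq)

cycAdj? : ∀ k i j → Dec (CycAdj k i j)
cycAdj? k i j = (toℕ j ℕ.≟ suc (toℕ i)) ⊎-dec ((toℕ i ℕ.≟ k ∸ 1) ×-dec (toℕ j ℕ.≟ 0))

cycAdj-suc : ∀ {k} (i : Fin k) → CycAdj (suc k) (inject₁ i) (suc i)
cycAdj-suc i = inj₁ (cong suc (≡.sym (Fin.toℕ-inject₁ i)))

cycAdj-wrap : ∀ k → CycAdj (suc k) (fromℕ k) zero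
cycAdj-wrap k = inj₂ (Fin.toℕ-fromℕ k , refl)

cycAdj-functional : ∀ {k} {i j j′ : Fin k} → CycAdj k i j → CycAdj k i j′ → j ≡ j′
cycAdj-functional (inj₁ p) (inj₁ q) = Fin.toℕ-injective (≡.trans p (≡.sym q))
cycAdj-functional (inj₂ (_ , p)) (inj₂ (_ , q)) = Fin.toℕ-injective (≡.trans p (≡.sym q))
cycAdj-functional {suc k} {j = j} (inj₁ p) (inj₂ (q , _)) =
  contradiction (Fin.toℕ<n j) (ℕ.≤⇒≯ (ℕ.≤-reflexive (≡.sym (≡.trans p (cong suc q)))))
cycAdj-functional {suc k} {j′ = j} (inj₂ (q , _)) (inj₁ p) =
  contradiction (Fin.toℕ<n j) (ℕ.≤⇒≯ (ℕ.≤-reflexive (≡.sym (≡.trans p (cong suc q)))))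

-- Forward steps alone suffice: climb from `i` to the last index, wrap around to zero, and climb
-- from there to `j`.
cycAdj-closed : ∀ {ℓ k} (P : Fin (suc k) → Set ℓ) → (∀ i j → CycAdj (suc k) i j → P i → P j) →
                ∀ i j → P i → P j
cycAdj-closed {k = k} P cl i j Pi =
  <-weakInduction P (cl _ _ (cycAdj-wrap k) P-last) (λ l → cl _ _ (cycAdj-suc l)) j
  where
  P-last : P (fromℕ k)
  P-last = <-weakInduction-startingFrom P Pi (λ l → cl _ _ (cycAdj-suc l)) (Fin.≤fromℕ i)

module _ {n k : ℕ} {C : SubG n} (f : Fin (suc k) → Fin n)
         (E-sym : ∀ u v → T (E C u v) → T (E C v u)) where

  private
    reverse : ∀ {u v} → Reach C u v → Reach C v u
    reverse = reach-sym E-sym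

  cyclic-connected : (∀ i → T (V C (f i))) →
                     (∀ i j → CycAdj (suc k) i j → T (E C (f i) (f j))) →
                     ∀ i j → Reach C (f i) (f j)
  cyclic-connected vert edge i j = reach-trans (reverse (from-zero i)) (from-zero j)
    where
    from-zero : ∀ i → Reach C (f zero) (f i)
    from-zero = <-weakInduction _ (here (vert zero))
      (λ i r → reach-trans r (step (vert _) (edge _ _ (cycAdj-suc i)) (here (vert _))))

  module _ (p : Fin (suc k)) (vert : ∀ i → i ≢ p → T (V C (f i)))
           (edge : ∀ i j → CycAdj (suc k) i j → i ≢ p → j ≢ p → T (E C (f i) (f j))) where

    private
      to-self : ∀ i → i ≢ p → Reach C (f i) (f i)
      to-self i i≢p = here (vert i i≢p)

      one-step : ∀ i j → CycAdj (suc k) i j → i ≢ p → j ≢ p → Reach C (f i) (f j)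
      one-step i j a i≢p j≢p = step (vert i i≢p) (edge i j a i≢p j≢p) (to-self j j≢p)

      from-zero : ∀ i → i Fin.< p → Reach C (f zero) (f i)
      from-zero = <-weakInduction _ (λ 0<p → to-self _ (Fin.<⇒≢ 0<p)) λ i r i+1<p →
        let i<p = ℕ.<-trans (ℕ.≤-reflexive (cong suc (Fin.toℕ-inject₁ i))) i+1<p
        in reach-trans (r i<p) (one-step _ _ (cycAdj-suc i) (Fin.<⇒≢ i<p) (Fin.<⇒≢ i+1<p))

      to-last : ∀ i → p Fin.< i → Reach C (f i) (f (fromℕ k))
      to-last i p<i = proj₂ (<-weakInduction-startingFrom (λ j → p Fin.< j × Reach C (f i) (f j))
        (p<i , to-self i (Fin.<⇒≢ p<i ∘ ≡.sym))
        (λ j (p<j , r) →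
          let p<j+1 = s≤s (ℕ.<⇒≤ (subst (toℕ p <_) (Fin.toℕ-inject₁ j) p<j))
          in p<j+1 , reach-trans r (one-step _ _ (cycAdj-suc j) (Fin.<⇒≢ p<j ∘ ≡.sym) (Fin.<⇒≢ p<j+1 ∘ ≡.sym)))
        (Fin.≤fromℕ i))

      across : ∀ i j → p Fin.< i → j Fin.< p → Reach C (f i) (f j)
      across i j p<i j<p = reach-trans (to-last i p<i) (reach-trans
        (one-step _ _ (cycAdj-wrap k)
          (Fin.<⇒≢ (ℕ.<-≤-trans p<i (Fin.≤fromℕ i)) ∘ ≡.sym)
          (Fin.<⇒≢ (ℕ.≤-<-trans z≤n j<p)))
        (from-zero j j<p))

    -- Without `p` the cycle becomes the path p+1, ..., k, 0, ..., p-1. Two indices on the same side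
    -- of `p` meet inside one of its two runs; indices on opposite sides are joined through the
    -- wrap-around pair.
    cyclic-minus-connected : ∀ i j → i ≢ p → j ≢ p → Reach C (f i) (f j)
    cyclic-minus-connected i j i≢p j≢p with Fin.<-cmp i p | Fin.<-cmp j p
    ... | tri≈ _ i≡p _ | _ = contradiction i≡p i≢p
    ... | tri< _ _ _ | tri≈ _ j≡p _ = contradiction j≡p j≢p
    ... | tri> _ _ _ | tri≈ _ j≡p _ = contradiction j≡p j≢p
    ... | tri< i<p _ _ | tri< j<p _ _ = reach-trans (reverse (from-zero i i<p)) (from-zero j j<p)
    ... | tri< i<p _ _ | tri> _ _ p<j = reverse (across j i p<j i<p)
    ... | tri> _ _ p<i | tri< j<p _ _ = across i j p<i j<p
    ... | tri> _ _ p<i | tri> _ _ p<j = reach-trans (to-last i p<i) (reverse (to-last j p<j))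

module _ {n : ℕ} where

  data CycPair (c : List (Fin n)) (u v : Fin n) : Set where
    cyc-pair : ∀ i j → CycAdj (length c) i j →
      (List.lookup c i ≡ u × List.lookup c j ≡ v) ⊎ (List.lookup c i ≡ v × List.lookup c j ≡ u) →
      CycPair c u v

  cycPair? : ∀ c u v → Dec (CycPair c u v)
  cycPair? c u v = Dec.map′ (λ (i , j , a , p) → cyc-pair i j a p) (λ { (cyc-pair i j a p) → i , j , a , p })
    (Fin.any? λ i → Fin.any? λ j → cycAdj? (length c) i j ×-dec
      (((List.lookup c i Fin.≟ u) ×-dec (List.lookup c j Fin.≟ v))
        ⊎-dec ((List.lookup c i Fin.≟ v) ×-dec (List.lookup c j Fin.≟ u))))

  open import Data.List.Membership.DecPropositional (Fin._≟_ {n}) public using (_∈?_)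

  cycPair-sym : ∀ {c u v} → CycPair c u v → CycPair c v u
  cycPair-sym (cyc-pair i j a p) = cyc-pair i j a (Sum.swap p)

  cycPair-∈ : ∀ {c u v} → CycPair c u v → u ∈ c × v ∈ c
  cycPair-∈ (cyc-pair i j _ (inj₁ (refl , refl))) = ∈-lookup i , ∈-lookup j
  cycPair-∈ (cyc-pair i j _ (inj₂ (refl , refl))) = ∈-lookup j , ∈-lookup i

  abstract
    -- A cyclic list of length two stands for a single edge.
    cyc : List (Fin n) → SubG n
    cyc c = mkSubG (λ v → ⌊ v ∈? c ⌋) (λ u v → ⌊ cycPair? c u v ⌋)

    cyc-V⁺ : ∀ {c v} → v ∈ c → T (V (cyc c) v)
    cyc-V⁺ {c} {v} = fromWitness {a? = v ∈? c}

    cyc-V⁻ : ∀ {c v} → T (V (cyc c) v) → v ∈ c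
    cyc-V⁻ {c} {v} = toWitness {a? = v ∈? c}

    cyc-E⁺ : ∀ {c u v} → CycPair c u v → T (E (cyc c) u v)
    cyc-E⁺ {c} {u} {v} = fromWitness {a? = cycPair? c u v}

    cyc-E⁻ : ∀ {c u v} → T (E (cyc c) u v) → CycPair c u v
    cyc-E⁻ {c} {u} {v} = toWitness {a? = cycPair? c u v}

  cyc-E-sym : ∀ {c} u v → T (E (cyc c) u v) → T (E (cyc c) v u)
  cyc-E-sym u v e = cyc-E⁺ (cycPair-sym (cyc-E⁻ e))

  module _ {x y : Fin n} {zs : List (Fin n)} (unique : Unique (x ∷ y ∷ zs)) where

    private
      c : List (Fin n)
      c = x ∷ y ∷ zs
      k : ℕ
      k = suc (length zs)
      f : Fin (suc k) → Fin n
      f = List.lookup c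

    -- In a list with a single entry the wrap-around would pair that entry with itself; a second
    -- entry keeps the last index away from zero.
    cycPair-irr : ∀ {v} → ¬ CycPair c v v
    cycPair-irr (cyc-pair i j a p) = go a (lookup-injective unique i j (both p))
      where
      both : ∀ {u v w : Fin n} → (u ≡ w × v ≡ w) ⊎ (u ≡ w × v ≡ w) → u ≡ v
      both (inj₁ (refl , refl)) = refl
      both (inj₂ (refl , refl)) = refl
      go : ∀ {i j} → CycAdj (suc k) i j → i ≡ j → ⊥
      go (inj₁ p) refl = ℕ.1+n≢n (≡.sym p)
      go (inj₂ (p , q)) refl = contradiction (≡.trans (≡.sym q) p) λ ()

    cyc-WF : WF (cyc c)
    cyc-WF = (λ u v → T-ext (cyc-E-sym u v) (cyc-E-sym v u)) ,
      (λ v → ≡false (λ e → cycPair-irr (cyc-E⁻ e))) ,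
      (λ u v e → let p , q = cycPair-∈ (cyc-E⁻ e) in cyc-V⁺ p , cyc-V⁺ q)
      where
      ≡false : ∀ {b} → ¬ T b → b ≡ false
      ≡false {false} _ = refl
      ≡false {true} p = contradiction tt p

    cyc-nonseparable : Nonseparable (cyc c)
    cyc-nonseparable = (x , cyc-V⁺ (here refl)) , connected , minus
      where
      connected : Connected (cyc c)
      connected u v p q = ≡.subst₂ (Reach (cyc c)) (≡.sym (lookup-index u∈c)) (≡.sym (lookup-index v∈c))
        (cyclic-connected {C = cyc c} f cyc-E-sym (λ i → cyc-V⁺ (∈-lookup i))
          (λ i j a → cyc-E⁺ (cyc-pair i j a (inj₁ (refl , refl)))) (Any.index u∈c) (Any.index v∈c))
        where
        u∈c = cyc-V⁻ p
        v∈c = cyc-V⁻ q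
      minus : ∀ w → T (V (cyc c) w) → Connected (cyc c -v w)
      minus w r u v p q = ≡.subst₂ (Reach (cyc c -v w)) (≡.sym (lookup-index u∈c)) (≡.sym (lookup-index v∈c))
        (cyclic-minus-connected {C = cyc c -v w} f
          (λ u v e → let u≢w , v≢w = E⇒≢ e in -v-E⁺ (cyc c) w (cyc-E-sym u v (-v-E⁻ (cyc c) w e)) v≢w u≢w)
          (Any.index w∈c)
          (λ i i≢ → -v-V⁺ (cyc c) w (cyc-V⁺ (∈-lookup i)) (lookup≢w i i≢))
          (λ i j a i≢ j≢ → -v-E⁺ (cyc c) w (cyc-E⁺ (cyc-pair i j a (inj₁ (refl , refl))))
                             (lookup≢w i i≢) (lookup≢w j j≢))
          (Any.index u∈c) (Any.index v∈c)
          (index≢ u∈c (proj₂ (-v-V⁻ (cyc c) w p))) (index≢ v∈c (proj₂ (-v-V⁻ (cyc c) w q))))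
        where
        w∈c = cyc-V⁻ r
        u∈c = cyc-V⁻ (proj₁ (-v-V⁻ (cyc c) w p))
        v∈c = cyc-V⁻ (proj₁ (-v-V⁻ (cyc c) w q))
        E⇒≢ : ∀ {u v} → T (E (cyc c -v w) u v) → u ≢ w × v ≢ w
        E⇒≢ {u} {v} e = let r , s = T-∧⁻ _ (proj₂ (T-∧⁻ (E (cyc c) u v) e)) in T-not-≡ᵇ⇒≢ r , T-not-≡ᵇ⇒≢ s
        lookup≢w : ∀ i → i ≢ Any.index w∈c → f i ≢ w
        lookup≢w i i≢ eq = i≢ (lookup-injective unique i _ (≡.trans eq (lookup-index w∈c)))
        index≢ : ∀ {t} (t∈c : t ∈ c) → t ≢ w → Any.index t∈c ≢ Any.index w∈c
        index≢ t∈c t≢w eq = t≢w (≡.trans (lookup-index t∈c) (≡.trans (cong f eq) (≡.sym (lookup-index w∈c))))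

-- Spanning SBEP implies toughness at least 1/2

-- Double negation commutes with finite conjunctions, by induction on `k`. This lets all components
-- make their choices at once inside a single negation.
¬¬-choice : ∀ {ℓ k} {P : Fin k → Set ℓ} → (∀ i → ¬ ¬ P i) → ¬ ¬ (∀ i → P i)
¬¬-choice {k = zero} h none = none λ ()
¬¬-choice {k = suc k} h none =
  h zero λ p₀ → ¬¬-choice (h ∘ suc) λ p → none λ { zero → p₀ ; (suc i) → p i }

firstTrue : ∀ {k} → (Fin (suc k) → Bool) → Fin (suc k)
-- The last index is also the default when no value is true.
firstTrue {zero} p = zero
firstTrue {suc k} p = if p zero then zero else suc (firstTrue (p ∘ suc))

firstTrue-cong : ∀ {k} {p q : Fin (suc k) → Bool} → (∀ i → p i ≡ q i) → firstTrue p ≡ firstTrue q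
firstTrue-cong {zero} h = refl
firstTrue-cong {suc k} {p} {q} h rewrite h zero | firstTrue-cong (h ∘ suc) = refl

firstTrue-sat : ∀ {k} (p : Fin (suc k) → Bool) i → T (p i) → T (p (firstTrue p))
firstTrue-sat {zero} p zero t = t
firstTrue-sat {suc k} p i t with p zero in eq
... | true = subst T (≡.sym eq) tt
firstTrue-sat {suc k} p zero t | false = ⊥-elim (subst T eq t)
firstTrue-sat {suc k} p (suc i) t | false = firstTrue-sat (p ∘ suc) i t

rank : ∀ {n} (S : Subset n) v → T (Vec.lookup S v) → Fin ∣ S ∣
rank (true ∷ S) zero _ = zero
rank (true ∷ S) (suc v) p = suc (rank S v p)
rank (false ∷ S) (suc v) p = rank S v p

rank-injective : ∀ {n} (S : Subset n) u v p q → rank S u p ≡ rank S v q → u ≡ v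
rank-injective (true ∷ S) zero zero p q eq = refl
rank-injective (true ∷ S) (suc u) (suc v) p q eq = cong suc (rank-injective S u v p q (Fin.suc-injective eq))
rank-injective (false ∷ S) (suc u) (suc v) p q eq = cong suc (rank-injective S u v p q eq)

module _ {n k : ℕ} (S : Subset n) (g : Fin k → Fin n) (g∈S : ∀ i → T (Vec.lookup S (g i)))
         (no-three : ∀ i j l → i ≢ j → i ≢ l → j ≢ l → g i ≡ g j → g i ≡ g l → ⊥) where

  private
    Repeated : Fin k → Set
    Repeated i = ∃ λ j → j Fin.< i × g j ≡ g i

    repeated? : ∀ i → Dec (Repeated i)
    repeated? i = Fin.any? λ j → (j Fin.<? i) ×-dec (g j Fin.≟ g i)

    flag : ∀ {P : Set} → Dec P → Fin 2
    flag (yes _) = zero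
    flag (no _) = suc zero

    flag-yes : ∀ {P Q : Set} (p? : Dec P) (q? : Dec Q) → flag p? ≡ flag q? → Q → P
    flag-yes (yes p) _ _ _ = p
    flag-yes (no _) (no ¬q) _ q = contradiction q ¬q

    slot : Fin k → Fin (2 * ∣ S ∣)
    slot i = combine (flag (repeated? i)) (rank S (g i) (g∈S i))

    -- A slot records the value of `g` and whether it occurred at an earlier index. If `i < j` share
    -- a slot, then `i` makes `j` a repetition, so by the equal flags `i` is one too, and an earlier
    -- `l` completes a forbidden triple.
    collision : ∀ i j → i Fin.< j → slot i ≢ slot j
    collision i j i<j eq = no-three l i j (Fin.<⇒≢ l<i) (Fin.<⇒≢ (ℕ.<-trans l<i i<j)) (Fin.<⇒≢ i<j)
        gl≡gi (≡.trans gl≡gi gi≡gj)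
      where
      gi≡gj : g i ≡ g j
      gi≡gj = rank-injective S (g i) (g j) (g∈S i) (g∈S j)
        (Fin.combine-injectiveʳ (flag (repeated? i)) _ (flag (repeated? j)) _ eq)
      rep : Repeated i
      rep = flag-yes (repeated? i) (repeated? j)
        (Fin.combine-injectiveˡ (flag (repeated? i)) _ (flag (repeated? j)) _ eq) (i , i<j , gi≡gj)
      l = proj₁ rep
      l<i = proj₁ (proj₂ rep)
      gl≡gi = proj₂ (proj₂ rep)

  at-most-two-to-one : k ≤ 2 * ∣ S ∣
  at-most-two-to-one = Fin.injective⇒≤ {f = slot} λ {i} {j} eq → inj i j eq
    where
    inj : ∀ i j → slot i ≡ slot j → i ≡ j
    inj i j eq with Fin.<-cmp i j
    ... | tri< i<j _ _ = contradiction eq (collision i j i<j)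
    ... | tri≈ _ i≡j _ = i≡j
    ... | tri> _ _ j<i = contradiction (≡.sym eq) (collision j i j<i)

module _ {n : ℕ} where

  infix 4 _≈_
  _≈_ : SubG n → SubG n → Set
  B ≈ C = (∀ v → V B v ≡ V C v) × (∀ u v → E B u v ≡ E C u v)

  ≈-sym : ∀ {B C} → B ≈ C → C ≈ B
  ≈-sym (p , q) = (λ v → ≡.sym (p v)) , (λ u v → ≡.sym (q u v))

  ≈-trans : ∀ {A B C} → A ≈ B → B ≈ C → A ≈ C
  ≈-trans (p , q) (p′ , q′) = (λ v → ≡.trans (p v) (p′ v)) , (λ u v → ≡.trans (q u v) (q′ u v))

  _≈?_ : ∀ B C → Dec (B ≈ C)
  B ≈? C = Fin.all? (λ v → V B v Bool.≟ V C v) ×-dec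
    Fin.all? (λ u → Fin.all? (λ v → E B u v Bool.≟ E C u v))

  ¬≈⇒Distinct : ∀ {B C} → ¬ B ≈ C → Distinct B C
  ¬≈⇒Distinct {B} {C} B≉C with Fin.all? (λ v → V B v Bool.≟ V C v)
  ... | no ¬all = inj₁ (Fin.¬∀⟶∃¬ n _ (λ v → V B v Bool.≟ V C v) ¬all)
  ... | yes all with Fin.any? (λ u → Fin.any? (λ v → ¬? (E B u v Bool.≟ E C u v)))
  ... | yes p = inj₂ p
  ... | no ¬any = contradiction
      (all , λ u v → decidable-stable (E B u v Bool.≟ E C u v) (λ ne → ¬any (u , v , ne))) B≉C

  -- The two facts about a cyclic orientation that the counting uses: successors are unique, and
  -- following them leads from any vertex of the block to any other. A single edge is oriented as a
  -- directed cycle of length two.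
  record Orientation (B : SubG n) : Set₁ where
    field
      Next : Fin n → Fin n → Set
      functional : ∀ {u v w} → Next u v → Next u w → v ≡ w
      closed : (P : Fin n → Set) → (∀ u w → T (E B u w) → Next u w → P u → P w) →
               ∀ u v → T (V B u) → T (V B v) → P u → P v
  open Orientation public

  orient-cycle : ∀ {B} → IsEvenCycle B → Orientation B
  orient-cycle {B} (m , f , f-inj , vert , edge) = record
    { Next = λ u v → ∃₂ λ i j → CycAdj _ i j × f i ≡ u × f j ≡ v
    ; functional = λ { (i , j , a , p , q) (i′ , j′ , a′ , p′ , q′) →
        next-unique i i′ a a′ (f-inj i i′ (≡.trans p (≡.sym p′))) q q′ }
    ; closed = λ P cl u v p q → around P cl (to (vert u) p) (to (vert v) q)
    }
    where
    next-unique : ∀ i i′ {j j′ v w} → CycAdj _ i j → CycAdj _ i′ j′ → i ≡ i′ → f j ≡ v → f j′ ≡ w → v ≡ w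
    next-unique i .i a a′ refl q q′ = ≡.trans (≡.sym q) (≡.trans (cong f (cycAdj-functional a a′)) q′)
    around : ∀ {u v} (P : Fin n → Set) → (∀ u w → T (E B u w) → _ → P u → P w) →
             (∃ λ i → f i ≡ u) → (∃ λ j → f j ≡ v) → P u → P v
    around P cl (i , refl) (j , refl) = cycAdj-closed (P ∘ f)
      (λ i j a → cl (f i) (f j) (from (edge _ _) (i , j , a , inj₁ (refl , refl))) (i , j , a , refl , refl)) i j

  orient-edge : ∀ {B} → IsSingleEdge B → Orientation B
  orient-edge {B} (a , b , a≢b , vert , edge) = record
    { Next = λ u v → (u ≡ a × v ≡ b) ⊎ (u ≡ b × v ≡ a)
    ; functional = λ where
        (inj₁ (_ , refl)) (inj₁ (_ , refl)) → refl
        (inj₂ (_ , refl)) (inj₂ (_ , refl)) → refl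
        (inj₁ (refl , _)) (inj₂ (eq , _)) → contradiction eq a≢b
        (inj₂ (refl , _)) (inj₁ (eq , _)) → contradiction (≡.sym eq) a≢b
    ; closed = λ P cl u v p q → across P cl (to (vert u) p) (to (vert v) q)
    }
    where
    across : ∀ {u v} (P : Fin n → Set) → (∀ u w → T (E B u w) → _ → P u → P w) →
             u ≡ a ⊎ u ≡ b → v ≡ a ⊎ v ≡ b → P u → P v
    across P cl (inj₁ refl) (inj₁ refl) p = p
    across P cl (inj₂ refl) (inj₂ refl) p = p
    across P cl (inj₁ refl) (inj₂ refl) p = cl _ _ (from (edge _ _) (inj₁ (refl , refl))) (inj₁ (refl , refl)) p
    across P cl (inj₂ refl) (inj₁ refl) p = cl _ _ (from (edge _ _) (inj₂ (refl , refl))) (inj₂ (refl , refl)) p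

  orient : ∀ {B} → IsEvenCycle B ⊎ IsSingleEdge B → Orientation B
  orient (inj₁ cycle) = orient-cycle cycle
  orient (inj₂ edge) = orient-edge edge

  cycPair-edge : ∀ {a b u v : Fin n} → CycPair (a ∷ b ∷ []) u v → (u ≡ a × v ≡ b) ⊎ (u ≡ b × v ≡ a)
  cycPair-edge (cyc-pair zero zero (inj₁ ()) _)
  cycPair-edge (cyc-pair zero zero (inj₂ (() , _)) _)
  cycPair-edge (cyc-pair zero (suc zero) _ (inj₁ (refl , refl))) = inj₁ (refl , refl)
  cycPair-edge (cyc-pair zero (suc zero) _ (inj₂ (refl , refl))) = inj₂ (refl , refl)
  cycPair-edge (cyc-pair (suc zero) zero _ (inj₁ (refl , refl))) = inj₂ (refl , refl)
  cycPair-edge (cyc-pair (suc zero) zero _ (inj₂ (refl , refl))) = inj₁ (refl , refl)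
  cycPair-edge (cyc-pair (suc zero) (suc zero) (inj₁ ()) _)
  cycPair-edge (cyc-pair (suc zero) (suc zero) (inj₂ (_ , ())) _)

  -- The cyclic list of the two ends is nonseparable, so some block lies above it. The fuel inferred
  -- in the proof is the full bound on `size`.
  edge-in-block : ∀ {H} → WF H → ∀ {a b} → T (E H a b) →
                  ¬ ¬ (∃ λ B → IsBlock H B × T (V B a) × T (V B b))
  edge-in-block {H} (H-sym , H-irr , H-ends) {a} {b} e none =
    block-above {H = H} _ (cyc ab) (cyc-WF unique) (vert , edge) (cyc-nonseparable unique)
      (ℕ.m≤n+m _ (size (cyc ab)))
      λ (B , block , (f , _)) → none (B , block , f a (cyc-V⁺ (here refl)) , f b (cyc-V⁺ (there (here refl))))
    where
    ab : List (Fin n)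
    ab = a ∷ b ∷ []
    unique : Unique ab
    unique = ((λ { refl → subst T (H-irr a) e }) ∷ []) ∷ [] ∷ []
    vert : ∀ v → T (V (cyc ab) v) → T (V H v)
    vert v p with cyc-V⁻ p
    ... | here refl = proj₁ (H-ends a b e)
    ... | there (here refl) = proj₂ (H-ends a b e)
    edge : ∀ u v → T (E (cyc ab) u v) → T (E H u v)
    edge u v p with cycPair-edge (cyc-E⁻ p)
    ... | inj₁ (refl , refl) = e
    ... | inj₂ (refl , refl) = subst T (H-sym a b) e

  module _ {G : Graph n} {H : SubG n} (H-WF : WF H) (spanning : ∀ v → T (V H v)) (H⊑G : H ⊑ full G)
           (connected : Connected H)
           (blocks : ∀ B → IsBlock H B → IsEvenCycle B ⊎ IsSingleEdge B)
           (two-blocks : ∀ v B₁ B₂ B₃ → IsBlock H B₁ → IsBlock H B₂ → IsBlock H B₃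
              → T (V B₁ v) → T (V B₂ v) → T (V B₃ v)
              → Distinct B₁ B₂ → Distinct B₁ B₃ → Distinct B₂ B₃ → ⊥)
           (S : Subset n) {k : ℕ} (comp : Fin n → Fin (suc (suc k)))
           (inhabited : ∀ i → ∃ λ v → T (V (G ⊖ S) v) × comp v ≡ i)
           (same-comp : ∀ u v → T (V (G ⊖ S) u) → T (V (G ⊖ S) v) → (comp u ≡ comp v ⇔ Reach (G ⊖ S) u v))
           where

    private
      K : ℕ
      K = suc (suc k)

      InS : Fin n → Set
      InS v = T (Vec.lookup S v)

      InComp : Fin K → Fin n → Set
      InComp i v = T (V (G ⊖ S) v) × comp v ≡ i

      inComp? : ∀ i v → Dec (InComp i v)
      inComp? i v = T? _ ×-dec (comp v Fin.≟ i)

      comp-step : ∀ {i u w} → T (E H u w) → InComp i u → ¬ InS w → InComp i w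
      comp-step {i} {u} {w} e (u∉S , eq) w∉S = T-not⁺ w∉S ,
        ≡.trans (≡.sym (from (same-comp u w u∉S (T-not⁺ w∉S))
          (step u∉S (T-∧⁺ (proj₂ H⊑G u w e) (T-∧⁺ u∉S (T-not⁺ w∉S))) (here (T-not⁺ w∉S))))) eq

      another : ∀ (i : Fin K) → ∃ λ j → i ≢ j
      another zero = suc zero , λ ()
      another (suc _) = zero , λ ()

      Touches : Fin K → SubG n → Set
      Touches i B = IsBlock H B × (∃ λ u → T (V B u) × InComp i u) × (∃ λ s → T (V B s) × InS s)

      -- As `H` is connected and a second component exists, some edge of `H` leaves component `i`.
      -- Its outer end lies in `S`, since an edge of `G - S` cannot join two components; a block
      -- through that edge meets both.
      touching : ∀ i → ¬ ¬ (∃ λ B → Touches i B)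
      touching i none with inhabited i | another i
      ... | u , p , eq | j , i≢j with inhabited j
      ... | v , p′ , eq′ with reach-crossing (inComp? i) (connected u v (spanning u) (spanning v)) (p , eq)
                               (λ (_ , eq″) → i≢j (≡.trans (≡.sym eq″) eq′))
      ... | x , y , e , Kx , ¬Ky = edge-in-block H-WF e λ (B , block , x∈B , y∈B) →
              none (B , block , (x , x∈B , Kx) ,
                    (y , y∈B , decidable-stable (T? _) (λ y∉S → ¬Ky (comp-step e Kx y∉S))))

      -- Components that chose equal blocks have to use the same orientation of it, so each
      -- block is replaced by the first equal one in the enumeration of the components.
      module _ (choice : ∀ i → ∃ λ B → Touches i B) where

        B : Fin K → SubG n
        B i = proj₁ (choice i)

        rep : Fin K → Fin K
        rep i = firstTrue (λ j → ⌊ B i ≈? B j ⌋)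

        ≈-rep : ∀ i → B i ≈ B (rep i)
        ≈-rep i = toWitness {a? = B i ≈? B (rep i)} (firstTrue-sat (λ j → ⌊ B i ≈? B j ⌋) i
          (fromWitness {a? = B i ≈? B i} ((λ _ → refl) , (λ _ _ → refl))))

        rep-cong : ∀ {i j} → B i ≈ B j → rep i ≡ rep j
        rep-cong {i} {j} i≈j = firstTrue-cong λ l → T-ext
          (λ p → fromWitness {a? = B j ≈? B l} (≈-trans (≈-sym i≈j) (toWitness {a? = B i ≈? B l} p)))
          (λ p → fromWitness {a? = B i ≈? B l} (≈-trans i≈j (toWitness {a? = B j ≈? B l} p)))

        orientation : ∀ r → Orientation (B r)
        orientation r = orient (blocks (B r) (proj₁ (proj₂ (choice r))))

        Entry : Fin K → Set
        Entry i = ∃₂ λ s w → InS s × T (V (B (rep i)) s) × Next (orientation (rep i)) s w × InComp i w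

        -- Suppose there is no entry. A vertex outside component `i` whose successor lies inside
        -- would have to be in `S` and would be an entry, so being outside is inherited by
        -- successors. Starting at `s`, it spreads over the whole block and reaches `u`, which is
        -- inside.
        entry : ∀ i → ¬ ¬ Entry i
        entry i none = closed (orientation r) (¬_ ∘ InComp i) advance s u s∈B u∈B (λ (s∉S , _) → T-not⁻ s∉S s∈S) Ku
          where
          r = rep i
          u = proj₁ (proj₁ (proj₂ (proj₂ (choice i))))
          Ku = proj₂ (proj₂ (proj₁ (proj₂ (proj₂ (choice i)))))
          u∈B = subst T (proj₁ (≈-rep i) u) (proj₁ (proj₂ (proj₁ (proj₂ (proj₂ (choice i))))))
          s = proj₁ (proj₂ (proj₂ (proj₂ (choice i))))
          s∈S = proj₂ (proj₂ (proj₂ (proj₂ (proj₂ (choice i)))))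
          s∈B = subst T (proj₁ (≈-rep i) s) (proj₁ (proj₂ (proj₂ (proj₂ (proj₂ (choice i))))))
          advance : ∀ x w → T (E (B r) x w) → Next (orientation r) x w → ¬ InComp i x → ¬ InComp i w
          advance x w e nxt ¬Kx Kw =
            let ((_ , _ , ends) , (_ , E⊆) , _) = proj₁ (proj₂ (choice r))
            in ¬Kx (comp-step (subst T (proj₁ H-WF x w) (E⊆ x w e)) Kw
                 λ x∈S → none (x , w , x∈S , proj₁ (ends x w e) , nxt , Kw))

        -- Components are sent to their entry vertices. Two components with the same entry vertex
        -- use different blocks there, because a common block would give them a common successor. So
        -- three components at one vertex would put it in three blocks.
        entries-bound : (∀ i → Entry i) → K ≤ 2 * ∣ S ∣
        entries-bound entries = at-most-two-to-one S s (proj₁ ∘ proj₂ ∘ proj₂ ∘ entries)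
          λ i j l i≢j i≢l j≢l si≡sj si≡sl →
            two-blocks (s i) (B (rep i)) (B (rep j)) (B (rep l)) (block i) (block j) (block l)
              (s∈B i) (subst (T ∘ V (B (rep j))) (≡.sym si≡sj) (s∈B j))
              (subst (T ∘ V (B (rep l))) (≡.sym si≡sl) (s∈B l))
              (distinct i j si≡sj i≢j) (distinct i l si≡sl i≢l) (distinct j l (≡.trans (≡.sym si≡sj) si≡sl) j≢l)
          where
          s : Fin K → Fin n
          s i = proj₁ (entries i)
          s∈B : ∀ i → T (V (B (rep i)) (s i))
          s∈B i = proj₁ (proj₂ (proj₂ (proj₂ (entries i))))
          block : ∀ i → IsBlock H (B (rep i))
          block i = proj₁ (proj₂ (choice (rep i)))
          next-unique : ∀ {r r′ u u′ v w} → r ≡ r′ → u ≡ u′ →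
            Next (orientation r) u v → Next (orientation r′) u′ w → v ≡ w
          next-unique refl refl = functional (orientation _)
          distinct : ∀ i j → s i ≡ s j → i ≢ j → Distinct (B (rep i)) (B (rep j))
          distinct i j si≡sj i≢j = ¬≈⇒Distinct λ same →
            let _ , w , _ , _ , nxt , Kw = entries i
                _ , w′ , _ , _ , nxt′ , Kw′ = entries j
                w≡w′ = next-unique (rep-cong (≈-trans (≈-rep i) (≈-trans same (≈-sym (≈-rep j))))) si≡sj nxt nxt′
            in i≢j (≡.trans (≡.sym (proj₂ Kw)) (≡.trans (cong comp w≡w′) (proj₂ Kw′)))

    components-bound : K ≤ 2 * ∣ S ∣
    components-bound = decidable-stable (K ℕ.≤? 2 * ∣ S ∣) λ not-le →
      ¬¬-choice touching λ choice → ¬¬-choice (entry choice) λ entries → not-le (entries-bound choice entries)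

-- Cotrees of P₄-free graphs

filter-↭-++ : ∀ {A : Set} {P : A → Set} (P? : ∀ x → Dec (P x)) xs →
              xs ↭ filter P? xs ++ filter (¬? ∘ P?) xs
filter-↭-++ P? [] = ↭-refl
filter-↭-++ P? (x ∷ xs) with P? x
... | yes _ = prep x (filter-↭-++ P? xs)
... | no _ = ↭-trans (prep x (filter-↭-++ P? xs)) (↭-sym (Perm.shift x (filter P? xs) _))

module _ {n : ℕ} (G : Graph n) where

  private
    adj-sym : ∀ {u v b} → adj G u v ≡ b → adj G v u ≡ b
    adj-sym p = ≡.trans (Defs.sym G _ _) p

  -- Adjacency is read as a colouring of pairs by `true` and `false`. Joins and unions are then
  -- splits of the two colours, and complementation only swaps the colours, so one argument treats
  -- both.
  Between : Bool → List (Fin n) → List (Fin n) → Set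
  Between c xs ys = ∀ {x y} → x ∈ xs → y ∈ ys → adj G x y ≡ c

  Between-sym : ∀ {c xs ys} → Between c xs ys → Between c ys xs
  Between-sym between p q = adj-sym (between q p)

  record Split (xs : List (Fin n)) : Set where
    constructor split
    field
      {left right} : List (Fin n)
      colour : Bool
      left-nonempty : 1 ≤ length left
      right-nonempty : 1 ≤ length right
      perm : xs ↭ left ++ right
      between : Between colour left right

  NoP4 : Bool → Set
  NoP4 c = ∀ a b d e → adj G a b ≡ c → adj G b d ≡ c → adj G d e ≡ c →
           adj G a d ≡ not c → adj G a e ≡ not c → adj G b e ≡ not c → ⊥

  -- P₄ is self-complementary.
  no-P4 : ¬ HasInducedP4 G → ∀ c → NoP4 c
  no-P4 free true a b d e ab bd de ad ae be =
    free (a , b , d , e ,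
      -- Adjacent vertices differ because there are no loops; each other pair is told apart by a
      -- third vertex adjacent to exactly one of the two.
      (edge⇒≢ ab , differ ae de , differ (adj-sym be) ab ∘ ≡.sym ,
        edge⇒≢ bd , differ (adj-sym ae) (adj-sym ab) ∘ ≡.sym , edge⇒≢ de) ,
      (ab , bd , de) , (ad , ae , be))
    where
    edge⇒≢ : ∀ {u v} → adj G u v ≡ true → u ≢ v
    edge⇒≢ p refl with () ← ≡.trans (≡.sym p) (irr G _)
    differ : ∀ {u v w} → adj G u w ≡ false → adj G v w ≡ true → u ≢ v
    differ p q refl with () ← ≡.trans (≡.sym p) q
  no-P4 free false a b d e ab bd de ad ae be =
    no-P4 free true d a e b (adj-sym ad) ae (adj-sym be) de (adj-sym bd) ab


  private
    -- The vertex v is added to a split of xs of colour not c; v sends c-edges to N and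
    -- (not c)-edges to M.  A c-edge between N and M must lie inside one half, and a
    -- c-neighbour of v in the other half would complete a P₄ of colour c.
    module _ {c : Bool} (noP4 : NoP4 c) (v : Fin n) {ys zs : List (Fin n)}
             (ys≥1 : 1 ≤ length ys) (zs≥1 : 1 ≤ length zs) (between : Between (not c) ys zs) where

      extend-edge : ∀ {w u} → w ∈ ys → u ∈ ys → adj G v w ≡ c → adj G v u ≡ not c → adj G w u ≡ c →
                    Split (v ∷ ys ++ zs)
      extend-edge {w} {u} w∈ys u∈ys vw vu wu with any? (λ z → adj G v z Bool.≟ c) zs
      ... | yes p = let z , z∈zs , vz = find p in
          ⊥-elim (noP4 u w v z (adj-sym wu) (adj-sym vw) vz (adj-sym vu) (between u∈ys z∈zs) (between w∈ys z∈zs))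
      ... | no none = split (not c) (s≤s z≤n) zs≥1 ↭-refl λ where
          (here refl) z∈zs → Bool.¬-not (none ∘ lose z∈zs)
          (there y∈ys) z∈zs → between y∈ys z∈zs

  Split-resp-↭ : ∀ {xs ys} → xs ↭ ys → Split ys → Split xs
  Split-resp-↭ p (split c l r q b) = split c l r (↭-trans p q) b

  -- If some `c`-edge runs between `N` and `M`, then `v` joins the half containing that edge.
  -- Otherwise `v ∷ N` against `M` is a split of colour `not c`; and if `M` is empty, `v` alone
  -- against the rest is a split of colour `c`.
  split-cons : (∀ c → NoP4 c) → ∀ v {xs} → Split xs → Split (v ∷ xs)
  split-cons noP4 v {xs} (split {ys} {zs} c′ ys≥1 zs≥1 perm between) = Split-resp-↭ (prep v perm) result
    where
    c : Bool
    c = not c′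
    between′ : Between (not c) ys zs
    between′ p q = ≡.trans (between p q) (≡.sym (Bool.not-involutive c′))
    rest = ys ++ zs
    N? = λ x → adj G v x Bool.≟ c
    N = filter N? rest
    M = filter (¬? ∘ N?) rest
    Mixed : Fin n → Fin n → Set
    Mixed w u = adj G v w ≡ c × adj G v u ≡ not c × adj G w u ≡ c
    mixed? : ∀ w u → Dec (Mixed w u)
    mixed? w u = (adj G v w Bool.≟ c) ×-dec (adj G v u Bool.≟ not c) ×-dec (adj G w u Bool.≟ c)
    from-mixed : ∀ {w u} → w ∈ rest → u ∈ rest → Mixed w u → Split (v ∷ rest)
    from-mixed w∈ u∈ (vw , vu , wu) with ∈-++⁻ ys w∈ | ∈-++⁻ ys u∈
    ... | inj₁ p | inj₁ q = extend-edge (noP4 c) v ys≥1 zs≥1 between′ p q vw vu wu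
    ... | inj₂ p | inj₂ q = Split-resp-↭ (prep v (Perm.++-comm ys zs))
        (extend-edge (noP4 c) v zs≥1 ys≥1 (Between-sym between′) p q vw vu wu)
    ... | inj₁ p | inj₂ q = contradiction (≡.trans (≡.sym wu) (between′ p q)) (Bool.not-¬ refl)
    ... | inj₂ p | inj₁ q = contradiction (≡.trans (≡.sym wu) (Between-sym between′ p q)) (Bool.not-¬ refl)
    rest≥1 : 1 ≤ length rest
    rest≥1 = ℕ.≤-trans ys≥1
      (subst (length ys ≤_) (≡.sym (List.length-++ ys)) (ℕ.m≤m+n (length ys) (length zs)))
    separate : ¬ Any (λ w → Any (Mixed w) rest) rest → ∀ M′ → M′ ≡ M → Split (v ∷ rest)
    separate none [] eq = split {left = [ v ]} {right = rest} c (s≤s z≤n) rest≥1 ↭-refl λ where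
      (here refl) x∈ → decidable-stable (N? _) λ ¬p →
         contradiction (subst (_ ∈_) (≡.sym eq) (∈-filter⁺ (¬? ∘ N?) x∈ ¬p)) λ ()
      (there ())
    separate none (_ ∷ _) eq = split {left = v ∷ N} (not c) (s≤s z≤n)
        (subst (λ M → 1 ≤ length M) eq (s≤s z≤n)) (prep v (filter-↭-++ N? rest)) λ where
      (here refl) u∈M → Bool.¬-not (proj₂ (∈-filter⁻ (¬? ∘ N?) {xs = rest} u∈M))
      (there w∈N) u∈M →
        let w∈ , vw = ∈-filter⁻ N? {xs = rest} w∈N
            u∈ , vu = ∈-filter⁻ (¬? ∘ N?) {xs = rest} u∈M
        in Bool.¬-not λ wu → none (lose w∈ (lose u∈ (vw , Bool.¬-not vu , wu)))
    result : Split (v ∷ rest)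
    result with any? (λ w → any? (mixed? w) rest) rest
    ... | yes p = let w , w∈ , q = find p ; u , u∈ , m = find q in from-mixed w∈ u∈ m
    ... | no none = separate none M refl

  cograph-split : (∀ c → NoP4 c) → ∀ x y zs → Split (x ∷ y ∷ zs)
  cograph-split noP4 x y [] = split {left = [ x ]} {right = [ y ]} (adj G x y) (s≤s z≤n) (s≤s z≤n) ↭-refl λ where
    (here refl) (here refl) → refl
    (here refl) (there ())
    (there ()) _
  cograph-split noP4 x y (z ∷ zs) = split-cons noP4 x (cograph-split noP4 y z zs)

  data Cotree : List (Fin n) → Set where
    leaf : ∀ v → Cotree [ v ]
    union : ∀ {xs ys zs} → Cotree ys → Cotree zs → Between false ys zs → xs ↭ ys ++ zs → Cotree xs
    join : ∀ {xs ys zs} → Cotree ys → Cotree zs → Between true ys zs → length ys ≤ length zs →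
           xs ↭ ys ++ zs → Cotree xs

  cotree : (∀ c → NoP4 c) → ∀ bound xs → 1 ≤ length xs → length xs ≤ bound → Cotree xs
  cotree noP4 (suc bound) (x ∷ []) _ _ = leaf x
  cotree noP4 (suc bound) (x ∷ y ∷ zs) _ (s≤s le) with cograph-split noP4 x y zs
  ... | split {ls} {rs} c ls≥1 rs≥1 perm between = node c between
    where
    total : length ls + length rs ≤ suc bound
    total = subst (_≤ suc bound) (≡.trans (↭-length perm) (List.length-++ ls)) (s≤s le)
    L : Cotree ls
    L = cotree noP4 bound ls ls≥1 (ℕ.≤-pred (ℕ.≤-trans
      (subst (_≤ length ls + length rs) (ℕ.+-comm (length ls) 1) (ℕ.+-monoʳ-≤ (length ls) rs≥1)) total))
    R : Cotree rs
    R = cotree noP4 bound rs rs≥1 (ℕ.≤-pred (ℕ.≤-trans (ℕ.+-monoˡ-≤ (length rs) ls≥1) total))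
    node : ∀ c → Between c ls rs → Cotree (x ∷ y ∷ zs)
    node false between = union L R between perm
    node true between with ℕ.≤-total (length ls) (length rs)
    ... | inj₁ le = join L R between le perm
    ... | inj₂ le = join R L (Between-sym between) le (↭-trans perm (Perm.++-comm ls rs))

-- Cuts witnessing the deficiency

unique-disjoint : ∀ {A : Set} xs {ys : List A} → Unique (xs ++ ys) → ∀ {x} → x ∈ xs → x ∉ ys
unique-disjoint (x ∷ xs) (p ∷ u) (here refl) x∈ys = All.lookup (All.++⁻ʳ xs p) x∈ys refl
unique-disjoint (x ∷ xs) (p ∷ u) (there x∈xs) x∈ys = unique-disjoint xs u x∈xs x∈ys

unique-++ˡ : ∀ {A : Set} xs {ys : List A} → Unique (xs ++ ys) → Unique xs
unique-++ˡ [] u = []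
unique-++ˡ (x ∷ xs) (p ∷ u) = All.++⁻ˡ xs p ∷ unique-++ˡ xs u

unique-++ʳ : ∀ {A : Set} xs {ys : List A} → Unique (xs ++ ys) → Unique ys
unique-++ʳ [] u = u
unique-++ʳ (x ∷ xs) (p ∷ u) = unique-++ʳ xs u

-- Disjointness of the lists makes the position of the one containing `x` independent of the
-- membership proof, so that a vertex has a well-defined component.
unique-index : ∀ {A : Set} {x : A} {xss} → Unique (concat xss) →
               (p q : Any (x ∈_) xss) → Any.index p ≡ Any.index q
unique-index u (here p) (here q) = refl
unique-index {xss = xs ∷ xss} u (here p) (there q) = contradiction (∈-concat⁺ q) (unique-disjoint xs u p)
unique-index {xss = xs ∷ xss} u (there p) (here q) = contradiction (∈-concat⁺ p) (unique-disjoint xs u q)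
unique-index {xss = xs ∷ xss} u (there p) (there q) = cong suc (unique-index (unique-++ʳ xs u) p q)

unique-resp-↭ : ∀ {A : Set} {xs ys : List A} → xs ↭ ys → Unique xs → Unique ys
unique-resp-↭ refl u = u
unique-resp-↭ (prep x p) (q ∷ u) = Perm.All-resp-↭ p q ∷ unique-resp-↭ p u
unique-resp-↭ (swap x y p) ((x≢y ∷ q) ∷ r ∷ u) =
  (x≢y ∘ ≡.sym ∷ Perm.All-resp-↭ p r) ∷ Perm.All-resp-↭ p q ∷ unique-resp-↭ p u
unique-resp-↭ (trans p q) u = unique-resp-↭ q (unique-resp-↭ p u)

allPairs-lookup : ∀ {A : Set} {R : A → A → Set} → (∀ {x y} → R x y → R y x) →
                  ∀ {xs} → AllPairs R xs → ∀ i j → i ≢ j → R (List.lookup xs i) (List.lookup xs j)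
allPairs-lookup R-sym (p ∷ ps) zero zero i≢j = contradiction refl i≢j
allPairs-lookup R-sym (p ∷ ps) zero (suc j) i≢j = All.lookup p (∈-lookup j)
allPairs-lookup R-sym (p ∷ ps) (suc i) zero i≢j = R-sym (All.lookup p (∈-lookup i))
allPairs-lookup R-sym (p ∷ ps) (suc i) (suc j) i≢j = allPairs-lookup R-sym ps i j (i≢j ∘ cong suc)

toSubset : ∀ {n} → List (Fin n) → Subset n
toSubset [] = Vec.replicate _ false
toSubset (x ∷ xs) = toSubset xs Vec.[ x ]≔ true

toSubset⁺ : ∀ {n} {xs : List (Fin n)} {v} → v ∈ xs → Vec.lookup (toSubset xs) v ≡ true
toSubset⁺ {xs = x ∷ xs} {v} p with v Fin.≟ x | p
... | yes refl | _ = Vec.lookup∘updateAt v (toSubset xs)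
... | no v≢x | here eq = contradiction eq v≢x
... | no v≢x | there q = ≡.trans (Vec.lookup∘updateAt′ v x v≢x (toSubset xs)) (toSubset⁺ q)

toSubset⁻ : ∀ {n} {xs : List (Fin n)} {v} → v ∉ xs → Vec.lookup (toSubset xs) v ≡ false
toSubset⁻ {xs = []} {v} _ = Vec.lookup-replicate v false
toSubset⁻ {xs = x ∷ xs} {v} v∉ =
  ≡.trans (Vec.lookup∘updateAt′ v x (v∉ ∘ here) (toSubset xs)) (toSubset⁻ (v∉ ∘ there))

∣update∣≤ : ∀ {n} (S : Subset n) x → ∣ S Vec.[ x ]≔ true ∣ ≤ suc ∣ S ∣
∣update∣≤ (true ∷ S) zero = ℕ.n≤1+n _
∣update∣≤ (false ∷ S) zero = ℕ.≤-refl
∣update∣≤ (true ∷ S) (suc x) = s≤s (∣update∣≤ S x)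
∣update∣≤ (false ∷ S) (suc x) = ∣update∣≤ S x

∣toSubset∣≤ : ∀ {n} (xs : List (Fin n)) → ∣ toSubset xs ∣ ≤ length xs
∣toSubset∣≤ {n} [] = ℕ.≤-reflexive (Subset.∣⊥∣≡0 n)
∣toSubset∣≤ (x ∷ xs) = ℕ.≤-trans (∣update∣≤ (toSubset xs) x) (s≤s (∣toSubset∣≤ xs))

module _ {n : ℕ} (G : Graph n) where

  cotree-nonempty : ∀ {xs} → Cotree G xs → 1 ≤ length xs
  cotree-nonempty (leaf v) = s≤s z≤n
  cotree-nonempty (union {ys = ys} S T _ perm) = subst (1 ≤_)
    (≡.sym (≡.trans (↭-length perm) (List.length-++ ys))) (ℕ.≤-trans (cotree-nonempty S) (ℕ.m≤m+n _ _))
  cotree-nonempty (join {ys = ys} S T _ _ perm) = subst (1 ≤_)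
    (≡.sym (≡.trans (↭-length perm) (List.length-++ ys))) (ℕ.≤-trans (cotree-nonempty S) (ℕ.m≤m+n _ _))

  -- This is max_S (c(G[xs] − S) − 2|S|): a set disconnecting a join contains one of its sides,
  -- and containing the larger side never pays off.
  deficiency : ∀ {xs} → Cotree G xs → ℕ
  deficiency (leaf v) = 1
  deficiency (union S T _ _) = deficiency S + deficiency T
  deficiency (join {ys = ys} S T _ _ _) = 1 ⊔ (deficiency T ∸ 2 * length ys)

  deficiency≤length : ∀ {xs} (T : Cotree G xs) → deficiency T ≤ length xs
  deficiency≤length (leaf v) = ℕ.≤-refl
  deficiency≤length (union {ys = ys} S T _ perm) = subst (_ ≤_)
    (≡.sym (≡.trans (↭-length perm) (List.length-++ ys))) (ℕ.+-mono-≤ (deficiency≤length S) (deficiency≤length T))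
  deficiency≤length J@(join {ys = ys} {zs} S T _ _ perm) = ℕ.⊔-lub (cotree-nonempty J)
    (subst (deficiency T ∸ 2 * length ys ≤_) (≡.sym (≡.trans (↭-length perm) (List.length-++ ys)))
      (ℕ.≤-trans (ℕ.m∸n≤m (deficiency T) (2 * length ys))
        (ℕ.≤-trans (deficiency≤length T) (ℕ.m≤n+m _ (length ys)))))

  -- The edges may stay those of `G`: `Reach` checks `V` at every vertex it visits, so paths cannot
  -- leave `xs`.
  within : List (Fin n) → SubG n
  within xs = mkSubG (λ v → ⌊ v ∈? xs ⌋) (adj G)

  within⁺ : ∀ {xs v} → v ∈ xs → T (V (within xs) v)
  within⁺ {xs} {v} = fromWitness {a? = v ∈? xs}

  within⁻ : ∀ {xs v} → T (V (within xs) v) → v ∈ xs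
  within⁻ {xs} {v} = toWitness {a? = v ∈? xs}

  ConnectedList : List (Fin n) → Set
  ConnectedList xs = (∃ λ v → v ∈ xs) × (∀ {u v} → u ∈ xs → v ∈ xs → Reach (within xs) u v)

  nonempty : ∀ {A : Set} {xs : List A} → 1 ≤ length xs → ∃ λ x → x ∈ xs
  nonempty {xs = x ∷ _} _ = x , here refl

  join-connected : ∀ {xs ys zs} → 1 ≤ length ys → 1 ≤ length zs → Between G true ys zs → xs ↭ ys ++ zs →
                   ConnectedList xs
  join-connected {xs} {ys} {zs} ys≥1 zs≥1 between perm with nonempty ys≥1 | nonempty zs≥1
  ... | y , y∈ys | z , z∈zs = (y , in-ys y∈ys) , λ p q → reach-trans (to-y p) (reach-sym symm (to-y q))
    where
    symm : ∀ u v → T (adj G u v) → T (adj G v u)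
    symm u v = subst T (Defs.sym G u v)
    in-ys : ∀ {v} → v ∈ ys → v ∈ xs
    in-ys p = ∈-resp-↭ (↭-sym perm) (∈-++⁺ˡ p)
    in-zs : ∀ {v} → v ∈ zs → v ∈ xs
    in-zs p = ∈-resp-↭ (↭-sym perm) (∈-++⁺ʳ ys p)
    across : ∀ {u v} → u ∈ ys → v ∈ zs → Reach (within xs) u v
    across p q = step (within⁺ (in-ys p)) (≡true⇒T (between p q)) (here (within⁺ (in-zs q)))
    to-y : ∀ {u} → u ∈ xs → Reach (within xs) u y
    to-y u∈ with ∈-++⁻ ys (∈-resp-↭ perm u∈)
    ... | inj₁ p = reach-trans (across p z∈zs) (reach-sym symm (across y∈ys z∈zs))
    ... | inj₂ p = reach-sym symm (across y∈ys p)

  -- A certificate for a component count: connected lists without edges between them are exactly the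
  -- components left when `removed` is deleted from `xs`.
  record Cut (xs : List (Fin n)) : Set where
    field
      comps : List (List (Fin n))
      removed : List (Fin n)
      perm : xs ↭ concat comps ++ removed
      connected : All ConnectedList comps
      separated : AllPairs (Between G false) comps
  open Cut

  cut-⊆ : ∀ {xs} (K : Cut xs) {c v} → c ∈ comps K → v ∈ c → v ∈ xs
  cut-⊆ K c∈ v∈ = ∈-resp-↭ (↭-sym (perm K)) (∈-++⁺ˡ (∈-concat⁺′ v∈ c∈))

  cut-whole : ∀ {xs} → ConnectedList xs → Cut xs
  cut-whole {xs} conn = record
    { comps = xs ∷ [] ; removed = []
    ; perm = ↭-reflexive (≡.sym (≡.trans (List.++-identityʳ _) (List.++-identityʳ xs)))
    ; connected = conn ∷ [] ; separated = [] ∷ [] }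

  cut-union : ∀ {xs ys zs} → Cut ys → Cut zs → Between G false ys zs → xs ↭ ys ++ zs → Cut xs
  cut-union {ys = ys} {zs} K L between p = record
    { comps = comps K ++ comps L
    ; removed = removed K ++ removed L
    ; perm = ↭-trans p (↭-trans (Perm.++⁺ (perm K) (perm L)) (↭-trans
        (interchange (concat (comps K)) (removed K) (concat (comps L)) (removed L))
        (↭-reflexive (cong (_++ (removed K ++ removed L)) (List.concat-++ (comps K) (comps L))))))
    ; connected = All.++⁺ (connected K) (connected L)
    ; separated = AllPairs.++⁺ (separated K) (separated L)
        (All.tabulate λ c∈ → All.tabulate λ d∈ u∈ v∈ → between (cut-⊆ K c∈ u∈) (cut-⊆ L d∈ v∈)) }
    where
    interchange : ∀ (as bs cs ds : List (Fin n)) → (as ++ bs) ++ (cs ++ ds) ↭ (as ++ cs) ++ (bs ++ ds)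
    interchange as bs cs ds = prove 4 ((a ⊕ b) ⊕ (c ⊕ d)) ((a ⊕ c) ⊕ (b ⊕ d)) (as ∷ bs ∷ cs ∷ ds ∷ [])
      where
      open import Algebra.Solver.CommutativeMonoid (++-commutativeMonoid {A = Fin n})
      a = var (# 0) ; b = var (# 1) ; c = var (# 2) ; d = var (# 3)

  cut-removing : ∀ {xs zs} ys → Cut zs → xs ↭ ys ++ zs → Cut xs
  cut-removing {xs} ys K p = record
    { comps = comps K ; removed = ys ++ removed K
    ; perm = ↭-trans p (↭-trans (Perm.++⁺ˡ ys (perm K)) (Perm.shifts ys (concat (comps K))))
    ; connected = connected K ; separated = separated K }

  -- At a union, the cuts of both sides are put together. At a join, a positive
  -- `deficiency T ∸ 2 * length ys` is reached by deleting all of `ys` besides a cut of `zs`; if it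
  -- is zero, deleting nothing leaves one component, since a join is connected.
  deficient-cut : ∀ {xs} (T : Cotree G xs) →
                  Σ (Cut xs) λ K → deficiency T + 2 * length (removed K) ≤ length (comps K)
  deficient-cut (leaf v) =
    cut-whole ((v , here refl) , λ { (here refl) (here refl) → here (within⁺ (here refl)) }) , ℕ.≤-refl
  deficient-cut (union S T between p) with deficient-cut S | deficient-cut T
  ... | K , le | L , le′ = cut-union K L between p , widen (ℕ.+-mono-≤ le le′)
    where
    open +-*-Solver
    rearrange : ∀ a b c d → (a + 2 * b) + (c + 2 * d) ≡ (a + c) + 2 * (b + d)
    rearrange = solve 4 (λ a b c d → (a :+ con 2 :* b) :+ (c :+ con 2 :* d) := (a :+ c) :+ con 2 :* (b :+ d)) refl
    widen : _ → _
    widen = ≡.subst₂ _≤_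
      (≡.trans (rearrange (deficiency S) (length (removed K)) (deficiency T) (length (removed L)))
        (cong (λ r → deficiency S + deficiency T + 2 * r) (≡.sym (List.length-++ (removed K)))))
      (≡.sym (List.length-++ (comps K)))
  deficient-cut (join {ys = ys} S T between _ p) with deficiency T ∸ 2 * length ys in eq | deficient-cut T
  ... | zero | _ = cut-whole (join-connected (cotree-nonempty S) (cotree-nonempty T) between p) , ℕ.≤-refl
  ... | suc e | K , le = cut-removing ys K p , subst (_≤ length (comps K)) count le
    where
    open +-*-Solver
    rearrange : ∀ e y r → (e + 2 * y) + 2 * r ≡ e + 2 * (y + r)
    rearrange = solve 3 (λ e y r → (e :+ con 2 :* y) :+ con 2 :* r := e :+ con 2 :* (y :+ r)) refl
    split-deficiency : deficiency T ≡ suc e + 2 * length ys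
    split-deficiency = ≡.trans (≡.sym (ℕ.m∸n+n≡m {deficiency T} {2 * length ys}
      (ℕ.<⇒≤ (ℕ.m∸n≢0⇒n<m (λ z → contradiction (≡.trans (≡.sym eq) z) λ ()))))) (cong (_+ 2 * length ys) eq)
    count : deficiency T + 2 * length (removed K) ≡ suc e + 2 * length (ys ++ removed K)
    count = ≡.trans (cong (_+ 2 * length (removed K)) split-deficiency)
      (≡.trans (rearrange (suc e) (length ys) _) (cong (λ r → suc e + 2 * r) (≡.sym (List.length-++ ys))))

  module _ (tough : IsTough G 1 2) (K : Cut (List.allFin n)) (several : 2 ≤ length (comps K)) where

    private
      S = toSubset (removed K)

      unique : Unique (concat (comps K) ++ removed K)
      unique = unique-resp-↭ (perm K) (allFin⁺ n)

      kept : ∀ {v} → T (V (G ⊖ S) v) → Any (v ∈_) (comps K)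
      kept {v} p with ∈-++⁻ (concat (comps K)) (∈-resp-↭ (perm K) (∈-allFin v))
      ... | inj₁ v∈ = ∈-concat⁻ (comps K) v∈
      ... | inj₂ v∈ = contradiction (≡true⇒T (toSubset⁺ v∈)) (T-not⁻ p)

      not-removed : ∀ {v} → Any (v ∈_) (comps K) → T (V (G ⊖ S) v)
      not-removed v∈ = subst (T ∘ not) (≡.sym (toSubset⁻ (unique-disjoint _ unique (∈-concat⁺ v∈)))) tt

      located? : ∀ v → Dec (Any (v ∈_) (comps K))
      located? v = any? (v ∈?_) (comps K)

      position : ∀ {v} → Dec (Any (v ∈_) (comps K)) → Fin (length (comps K))
      position (yes p) = Any.index p
      -- Removed vertices get index 0 as a default; `HasComponents` constrains its labelling only on
      -- the vertices of `G ⊖ S`.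
      position (no _) = Fin.fromℕ< (ℕ.<-trans (s≤s z≤n) several)

      comp : Fin n → Fin (length (comps K))
      comp v = position (located? v)

      comp-index : ∀ {v} (p : Any (v ∈_) (comps K)) → comp v ≡ Any.index p
      comp-index {v} p with located? v
      ... | yes q = unique-index (unique-++ˡ (concat (comps K)) unique) q p
      ... | no ¬p = contradiction p ¬p

      in-comp : ∀ {v} → T (V (G ⊖ S) v) → v ∈ List.lookup (comps K) (comp v)
      in-comp {v} p = subst (λ i → v ∈ List.lookup (comps K) i) (≡.sym (comp-index (kept p))) (lookup-index (kept p))

      in-comp⁻ : ∀ {v} i → v ∈ List.lookup (comps K) i → Any (v ∈_) (comps K)
      in-comp⁻ i v∈ = lose (∈-lookup i) v∈

      comp-unique : ∀ {v} i → v ∈ List.lookup (comps K) i → comp v ≡ i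
      comp-unique i v∈ = ≡.trans (comp-index (in-comp⁻ i v∈)) (lose-index (comps K) i v∈)
        where
        lose-index : ∀ {v} (xss : List (List (Fin n))) i (p : v ∈ List.lookup xss i) →
                     Any.index (lose {P = v ∈_} (∈-lookup {xs = xss} i) p) ≡ i
        lose-index (xs ∷ xss) zero p = refl
        lose-index (xs ∷ xss) (suc i) p = cong suc (lose-index xss i p)

      -- Connectedness of each list supplies the paths for equal labels. Conversely no edge of
      -- `G ⊖ S` joins two different lists, so the label is constant along every path.
      has-components : HasComponents (G ⊖ S) (length (comps K))
      has-components = comp , inhabited , λ u v p q → mk⇔ (joined u v p q) (λ r → ≡.sym (same u v r))
        where
        inhabited : ∀ i → ∃ λ v → T (V (G ⊖ S) v) × comp v ≡ i
        inhabited i = let (v , v∈) , _ = All.lookup (connected K) (∈-lookup i)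
                      in v , not-removed (in-comp⁻ i v∈) , comp-unique i v∈
        joined : ∀ u v → T (V (G ⊖ S) u) → T (V (G ⊖ S) v) → comp u ≡ comp v → Reach (G ⊖ S) u v
        joined u v p q eq = reach-map (λ _ → vert) (λ _ _ a b e → T-∧⁺ e (T-∧⁺ (vert a) (vert b)))
          (proj₂ (All.lookup (connected K) (∈-lookup (comp u))) (in-comp p)
            (subst (λ i → v ∈ List.lookup (comps K) i) (≡.sym eq) (in-comp q)))
          where
          vert : ∀ {w} → T (V (within (List.lookup (comps K) (comp u))) w) → T (V (G ⊖ S) w)
          vert = not-removed ∘ in-comp⁻ (comp u) ∘ within⁻
        same : ∀ u v → Reach (G ⊖ S) u v → comp v ≡ comp u
        same u v r = reach-closed (λ w → comp w ≡ comp u) advance r refl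
          where
          advance : ∀ w x → T (V (G ⊖ S) w) → T (V (G ⊖ S) x) → T (E (G ⊖ S) w x) →
                    comp w ≡ comp u → comp x ≡ comp u
          advance w x p q e eq with comp w Fin.≟ comp x
          ... | yes same = ≡.trans (≡.sym same) eq
          ... | no differ with () ← ≡.trans (≡.sym (T⇒≡true (proj₁ (T-∧⁻ (adj G w x) e))))
                (allPairs-lookup (Between-sym G) (separated K) (comp w) (comp x) differ (in-comp p) (in-comp q))

    tough-cut : length (comps K) ≤ 2 * length (removed K)
    tough-cut = ℕ.≤-trans (subst (_≤ 2 * ∣ S ∣) (ℕ.*-identityˡ _) 
        (tough S (length (comps K)) has-components several))
      (ℕ.*-monoʳ-≤ 2 (∣toSubset∣≤ (removed K)))

-- Covering a cograph by pieces

split-at : ∀ {A : Set} j (xs : List A) → j ≤ length xs → ∃₂ λ ys zs → xs ≡ ys ++ zs × length ys ≡ j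
split-at zero xs _ = [] , xs , refl , refl
split-at (suc j) (x ∷ xs) (s≤s le) with split-at j xs le
... | ys , zs , eq , len = x ∷ ys , zs , cong (x ∷_) eq , cong suc len

module _ {n : ℕ} (G : Graph n) where

  -- A node together with the roots of its piece forms a block: a single edge if the piece
  -- has one root, otherwise a cycle, which is even because pieces have an odd number of roots.
  data Tree : Fin n → Set
  data Piece : Fin n → Fin n → Set

  data Tree where
    leaf : ∀ v → Tree v
    node : ∀ v {a b} → adj G v a ≡ true → adj G v b ≡ true → Piece a b → Tree v

  data Piece where
    one : ∀ {a} → Tree a → Piece a a
    chain : ∀ {a b c d} → Tree a → adj G a b ≡ true → Tree b → adj G b c ≡ true → Piece c d → Piece a d

  below : ∀ {v} → Tree v → List (Fin n)
  verts : ∀ {a b} → Piece a b → List (Fin n)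

  below (leaf v) = []
  below (node v _ _ p) = verts p

  verts (one {a} t) = a ∷ below t
  verts (chain {a} {b} s _ t _ p) = (a ∷ below s) ++ (b ∷ below t) ++ verts p

  first∈verts : ∀ {a b} (p : Piece a b) → a ∈ verts p
  first∈verts (one t) = here refl
  first∈verts (chain s _ t _ p) = here refl

  last∈verts : ∀ {a b} (p : Piece a b) → b ∈ verts p
  last∈verts (one t) = here refl
  last∈verts (chain {a} {b} s _ t _ p) = ∈-++⁺ʳ (a ∷ below s) (∈-++⁺ʳ (b ∷ below t) (last∈verts p))

  link : ∀ {a b c d e} → Piece a b → adj G b c ≡ true → Tree c → adj G c d ≡ true → Piece d e → Piece a e
  link (one s) bc t cd q = chain s bc t cd q
  link (chain s e₁ s′ e₂ p) bc t cd q = chain s e₁ s′ e₂ (link p bc t cd q)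

  verts-link : ∀ {a b c d e} (p : Piece a b) (bc : adj G b c ≡ true) (t : Tree c) (cd : adj G c d ≡ true)
               (q : Piece d e) → verts (link p bc t cd q) ≡ verts p ++ (c ∷ below t) ++ verts q
  verts-link (one s) bc t cd q = refl
  verts-link {c = c} (chain {a} {b} s e₁ s′ e₂ p) bc t cd q = ≡.trans
    (cong (λ l → (a ∷ below s) ++ (b ∷ below s′) ++ l) (verts-link p bc t cd q))
    (≡.trans (cong ((a ∷ below s) ++_) (≡.sym (List.++-assoc (b ∷ below s′) (verts p) _)))
             (≡.sym (List.++-assoc (a ∷ below s) ((b ∷ below s′) ++ verts p) _)))

  record Part : Set where
    constructor part
    field
      {first} {last} : Fin n
      body : Piece first last
  open Part

  Parts : Set
  Parts = List Part

  partsVerts : Parts → List (Fin n)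
  partsVerts [] = []
  partsVerts (p ∷ ps) = verts (body p) ++ partsVerts ps

  EndsIn : List (Fin n) → Part → Set
  EndsIn zs p = first p ∈ zs × last p ∈ zs

  Cover : List (Fin n) → ℕ → Set
  Cover xs m = ∃ λ ps → length ps ≡ m × partsVerts ps ↭ xs

  ends-in : ∀ ps {zs} → (∀ {v} → v ∈ partsVerts ps → v ∈ zs) → All (EndsIn zs) ps
  ends-in [] _ = []
  ends-in (p ∷ ps) sub = (sub (∈-++⁺ˡ (first∈verts (body p))) , sub (∈-++⁺ˡ (last∈verts (body p)))) ∷
    ends-in ps (sub ∘ ∈-++⁺ʳ (verts (body p)))

  private
    module _ where
      open import Algebra.Solver.CommutativeMonoid (++-commutativeMonoid {A = Fin n})

      link₂-↭ : ∀ a ps qs rs as → as ++ ((ps ++ [ a ] ++ qs) ++ rs) ↭ (a ∷ as) ++ ps ++ qs ++ rs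
      link₂-↭ a ps qs rs as = prove 5
        (vas ⊕ ((vp ⊕ (va ⊕ vq)) ⊕ vr)) ((va ⊕ vas) ⊕ (vp ⊕ (vq ⊕ vr))) ([ a ] ∷ ps ∷ qs ∷ rs ∷ as ∷ [])
        where va = var (# 0) ; vp = var (# 1) ; vq = var (# 2) ; vr = var (# 3) ; vas = var (# 4)

      link₃-↭ : ∀ a ps qs rs ss as → as ++ ((ps ++ (a ∷ rs) ++ qs) ++ ss) ↭ (a ∷ as) ++ ps ++ qs ++ rs ++ ss
      link₃-↭ a ps qs rs ss as = prove 6
        (vas ⊕ ((vp ⊕ ((va ⊕ vr) ⊕ vq)) ⊕ vs)) ((va ⊕ vas) ⊕ (vp ⊕ (vq ⊕ (vr ⊕ vs)))) 
        ([ a ] ∷ ps ∷ qs ∷ rs ∷ ss ∷ as ∷ [])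
        where va = var (# 0) ; vp = var (# 1) ; vq = var (# 2)
              vr = var (# 3) ; vs = var (# 4) ; vas = var (# 5)

      hang-↭ : ∀ a ps rs as → (a ∷ ps) ++ (as ++ rs) ↭ (a ∷ as) ++ ps ++ rs
      hang-↭ a ps rs as = prove 4
        ((va ⊕ vp) ⊕ (vas ⊕ vr)) ((va ⊕ vas) ⊕ (vp ⊕ vr)) ([ a ] ∷ ps ∷ rs ∷ as ∷ [])
        where va = var (# 0) ; vp = var (# 1) ; vr = var (# 2) ; vas = var (# 3)

  -- Each vertex of `as` links two pieces and so saves one; the first `e` of them also close a third
  -- piece below themselves and save two. The linking vertex becomes interior, so all ends stay in
  -- `zs` and the next vertex is adjacent to them.
  merge : ∀ {zs} as k e ps → Between G true as zs → All (EndsIn zs) ps →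
          length ps ≡ suc k + length as + e → e ≤ length as →
          ∃ λ qs → length qs ≡ suc k × All (EndsIn zs) qs × partsVerts qs ↭ as ++ partsVerts ps
  merge [] k zero ps _ ends len _ =
    ps , ≡.trans len (≡.trans (ℕ.+-identityʳ _) (ℕ.+-identityʳ _)) , ends , ↭-refl
  merge (a ∷ as) k zero ps between ends len _ = go ps ends (≡.trans len (cong (_+ 0) (ℕ.+-suc (suc k) (length as))))
    where
    go : ∀ ps → All (EndsIn _) ps → length ps ≡ suc (suc (k + length as + 0)) →
         ∃ λ qs → length qs ≡ suc k × All (EndsIn _) qs × partsVerts qs ↭ (a ∷ as) ++ partsVerts ps
    go (p ∷ q ∷ rs) ((p₁ , p₂) ∷ (q₁ , q₂) ∷ ends) len
      with merge as k zero (part (link (body p) (Between-sym G between p₂ (here refl))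
               (leaf a) (between (here refl) q₁) (body q)) ∷ rs)
             (between ∘ there) ((p₁ , q₂) ∷ ends) (ℕ.suc-injective len) z≤n
    ... | qs , len′ , ends′ , perm = qs , len′ , ends′ , ↭-trans perm
      (subst (λ l → as ++ (l ++ partsVerts rs) ↭ _) (≡.sym (verts-link (body p) _ (leaf a) _ (body q)))
        (link₂-↭ a (verts (body p)) (verts (body q)) (partsVerts rs) as))
  merge (a ∷ as) k (suc e) ps between ends len (s≤s e≤) = go ps ends
      (≡.trans len (≡.trans (cong (_+ suc e) (ℕ.+-suc (suc k) (length as))) (ℕ.+-suc _ e)))
    where
    go : ∀ ps → All (EndsIn _) ps → length ps ≡ suc (suc (suc (k + length as + e))) →
         ∃ λ qs → length qs ≡ suc k × All (EndsIn _) qs × partsVerts qs ↭ (a ∷ as) ++ partsVerts ps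
    go (p ∷ q ∷ r ∷ rs) ((p₁ , p₂) ∷ (q₁ , q₂) ∷ (r₁ , r₂) ∷ ends) len
      with merge as k e (part (link (body p) (Between-sym G between p₂ (here refl))
               (node a (between (here refl) r₁) (between (here refl) r₂) (body r))
               (between (here refl) q₁) (body q)) ∷ rs)
             (between ∘ there) ((p₁ , q₂) ∷ ends) (ℕ.suc-injective (ℕ.suc-injective len)) e≤
    ... | qs , len′ , ends′ , perm = qs , len′ , ends′ , ↭-trans perm
      (subst (λ l → as ++ (l ++ partsVerts rs) ↭ _) (≡.sym (verts-link (body p) _ _ _ (body q)))
        (link₃-↭ a (verts (body p)) (verts (body q)) (verts (body r)) (partsVerts rs) as))

  -- Absorbs vertices at a constant number of pieces: `a` together with `p` closes up to a block,
  -- and the result is a piece whose only root is `a`. Its ends no longer lie in `zs`.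
  hang : ∀ {zs} as ps → Between G true as zs → All (EndsIn zs) ps → length as ≤ length ps →
         ∃ λ qs → length qs ≡ length ps × partsVerts qs ↭ as ++ partsVerts ps
  hang [] ps _ _ _ = ps , refl , ↭-refl
  hang (a ∷ as) (p ∷ ps) between ((p₁ , p₂) ∷ ends) (s≤s le) with hang as ps (between ∘ there) ends le
  ... | qs , len , perm = part (one (node a (between (here refl) p₁) (between (here refl) p₂) (body p))) ∷ qs ,
      cong suc len , ↭-trans (Perm.++⁺ˡ (a ∷ verts (body p)) perm) (hang-↭ a (verts (body p)) (partsVerts ps) as)

  singletons : List (Fin n) → Parts
  singletons = List.map (λ a → part (one (leaf a)))

  add-singletons : ∀ as ps → partsVerts (singletons as ++ ps) ≡ as ++ partsVerts ps
  add-singletons [] ps = refl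
  add-singletons (a ∷ as) ps = cong (a ∷_) (add-singletons as ps)

  module _ {ys zs : List (Fin n)} (between : Between G true ys zs) (d : ℕ) (d≤ : d ≤ length zs)
           (ys≤zs : length ys ≤ length zs) (cover : ∀ m → d ≤ m → m ≤ length zs → Cover zs m) where

    private
      s = length ys
      N = length zs

      cover-ends : ∀ {m} ((ps , _) : Cover zs m) → All (EndsIn zs) ps
      cover-ends (ps , _ , perm) = ends-in ps (∈-resp-↭ perm)

    -- Starting from `suc k + s` pieces of `zs`, the `s` vertices of `ys` save one each. If `d`
    -- forbids so few pieces, start from `d`; the surplus over `suc k + s` is at most `s` and is
    -- absorbed by vertices saving two.
    merge-all : ∀ k → s + suc k ≤ N → d ≤ suc k + 2 * s →
                ∃ λ qs → length qs ≡ suc k × All (EndsIn zs) qs × partsVerts qs ↭ ys ++ zs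
    merge-all k le d≤k+2s with cover (d ⊔ (suc k + s)) (ℕ.m≤m⊔n d _)
                                 (ℕ.⊔-lub d≤ (subst (_≤ N) (ℕ.+-comm s (suc k)) le))
    ... | c@(ps , len , perm) with merge ys k (d ⊔ (suc k + s) ∸ (suc k + s)) ps between (cover-ends c)
            (≡.trans len (≡.sym (ℕ.m+[n∸m]≡n (ℕ.m≤n⊔m d (suc k + s)))))
            (ℕ.≤-trans (ℕ.∸-monoˡ-≤ (suc k + s) (ℕ.⊔-lub
                (subst (d ≤_) (≡.trans (cong (λ x → suc k + (s + x)) (ℕ.+-identityʳ s))
                                       (≡.sym (ℕ.+-assoc (suc k) s s))) d≤k+2s)
                (ℕ.m≤m+n (suc k + s) s)))
              (ℕ.≤-reflexive (ℕ.m+n∸m≡n (suc k + s) s)))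
    ... | qs , len′ , ends , perm′ = qs , len′ , ends , ↭-trans perm′ (Perm.++⁺ˡ ys perm)

    -- There are three ranges. For `N ≤ k`, start from `N` pieces of `zs`; `k ∸ N` vertices of `ys`
    -- become pieces of their own, and each other one has a piece hung on it. For `s + k ≤ N`, every
    -- vertex of `ys` merges. In between, `N ∸ k` vertices save one piece each and the others have
    -- pieces hung on them; the `k` remaining pieces are enough because `s ≤ N`.
    cover-join : ∀ k → 1 ⊔ (d ∸ 2 * s) ≤ k → k ≤ s + N → Cover (ys ++ zs) k
    cover-join zero lo _ with () ← ℕ.≤-trans (ℕ.m≤m⊔n 1 (d ∸ 2 * s)) lo
    cover-join k@(suc k′) lo hi with ℕ.≤-total N k
    ... | inj₁ N≤k with split-at (k ∸ N) ys (ℕ.≤-trans (ℕ.∸-monoˡ-≤ N hi) (ℕ.≤-reflexive (ℕ.m+n∸n≡m s N)))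
    ...   | as , bs , refl , len-as with cover N d≤ ℕ.≤-refl
    ...     | c@(ps , len , perm) with hang bs ps (between ∘ ∈-++⁺ʳ as) (cover-ends c)
                (ℕ.≤-trans (ℕ.m≤n+m (length bs) (length as))
                  (ℕ.≤-trans (subst (_≤ N) (List.length-++ as) ys≤zs) (ℕ.≤-reflexive (≡.sym len))))
    ...       | qs , len′ , perm′ = singletons as ++ qs ,
                ≡.trans (List.length-++ (singletons as))
                  (≡.trans (cong₂ _+_ (≡.trans (List.length-map _ as) len-as) (≡.trans len′ len)) (ℕ.m∸n+n≡m N≤k)) ,
                ↭-trans (↭-reflexive (add-singletons as qs))
                  (↭-trans (Perm.++⁺ˡ as (↭-trans perm′ (Perm.++⁺ˡ bs perm)))
                    (↭-reflexive (≡.sym (List.++-assoc as bs zs))))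
    cover-join k@(suc k′) lo hi | inj₂ k≤N with ℕ.≤-total (s + k) N
    ... | inj₁ s+k≤N = let qs , len , _ , perm = merge-all k′ s+k≤N d≤k+2s in qs , len , perm
      where
      d≤k+2s : d ≤ k + 2 * s
      d≤k+2s = ℕ.≤-trans (ℕ.m≤n+m∸n d (2 * s)) (ℕ.≤-trans
        (ℕ.+-monoʳ-≤ (2 * s) (ℕ.≤-trans (ℕ.m≤n⊔m 1 _) lo)) (ℕ.≤-reflexive (ℕ.+-comm (2 * s) k)))
    ... | inj₂ N≤s+k with split-at (N ∸ k) ys (ℕ.≤-trans (ℕ.∸-monoˡ-≤ k N≤s+k) (ℕ.≤-reflexive (ℕ.m+n∸n≡m s k)))
    ...   | as , bs , refl , len-as with cover N d≤ ℕ.≤-refl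
    ...     | c@(ps , len , perm) with merge as k′ 0 ps (between ∘ ∈-++⁺ˡ) (cover-ends c)
                (≡.trans len (≡.trans N≡k+as (≡.sym (ℕ.+-identityʳ _)))) z≤n
        where
        N≡k+as : N ≡ k + length as
        N≡k+as = ≡.trans (≡.sym (ℕ.m+[n∸m]≡n k≤N)) (cong (k +_) (≡.sym len-as))
    ...       | qs , len′ , ends , perm′ with hang bs qs (between ∘ ∈-++⁺ʳ as) ends
                (subst (length bs ≤_) (≡.sym len′) (ℕ.+-cancelˡ-≤ (length as) _ _
                  (ℕ.≤-trans (subst (_≤ N) (List.length-++ as) ys≤zs)
                    (ℕ.≤-reflexive (≡.trans (≡.sym (ℕ.m∸n+n≡m k≤N)) (cong (_+ k) (≡.sym len-as)))))))
    ...         | rs , len″ , perm″ = rs , ≡.trans len″ len′ ,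
                ↭-trans perm″ (↭-trans (Perm.++⁺ˡ bs (↭-trans perm′ (Perm.++⁺ˡ as perm)))
                  (↭-trans (Perm.shifts bs as) (↭-reflexive (≡.sym (List.++-assoc as bs zs)))))

  parts-++ : ∀ ps qs → partsVerts (ps ++ qs) ≡ partsVerts ps ++ partsVerts qs
  parts-++ [] qs = refl
  parts-++ (p ∷ ps) qs = ≡.trans (cong (verts (body p) ++_) (parts-++ ps qs))
    (≡.sym (List.++-assoc (verts (body p)) (partsVerts ps) (partsVerts qs)))

  cover-++ : ∀ {ys zs k l} → Cover ys k → Cover zs l → Cover (ys ++ zs) (k + l)
  cover-++ (ps , len , perm) (qs , len′ , perm′) = ps ++ qs ,
    ≡.trans (List.length-++ ps) (cong₂ _+_ len len′) ,
    ↭-trans (↭-reflexive (parts-++ ps qs)) (Perm.++⁺ perm perm′)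

  cover-↭ : ∀ {xs ys k} → xs ↭ ys → Cover ys k → Cover xs k
  cover-↭ p (ps , len , perm) = ps , len , ↭-trans perm (↭-sym p)

  deficiency-cover : ∀ {xs} (T : Cotree G xs) m → deficiency G T ≤ m → m ≤ length xs → Cover xs m
  deficiency-cover (leaf v) m lo hi =
    part (one (leaf v)) ∷ [] , ℕ.≤-antisym lo hi , ↭-refl
  deficiency-cover (union {ys = ys} {zs} S T _ p) m lo hi = cover-↭ p
      (by-cases (ℕ.≤-total (m ∸ deficiency G T) (length ys)))
    where
    m≤ : m ≤ length ys + length zs
    m≤ = subst (m ≤_) (≡.trans (↭-length p) (List.length-++ ys)) hi
    by-cases : _ → Cover (ys ++ zs) m
    -- The right side gets its minimum and the left side the rest, as long as this fits into `ys`;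
    -- otherwise the left side is filled to `length ys` and the right side takes the remainder.
    by-cases (inj₁ le) = subst (Cover (ys ++ zs)) (ℕ.m∸n+n≡m (ℕ.m+n≤o⇒n≤o (deficiency G S) lo))
      (cover-++ (deficiency-cover S (m ∸ deficiency G T) (ℕ.m+n≤o⇒m≤o∸n (deficiency G S) lo) le)
                (deficiency-cover T (deficiency G T) ℕ.≤-refl (deficiency≤length G T)))
    by-cases (inj₂ le) = subst (Cover (ys ++ zs)) (ℕ.m+[n∸m]≡n (ℕ.≤-trans le (ℕ.m∸n≤m m (deficiency G T))))
      (cover-++ (deficiency-cover S (length ys) (deficiency≤length G S) ℕ.≤-refl)
                (deficiency-cover T (m ∸ length ys) (ℕ.m+n≤o⇒m≤o∸n (deficiency G T)
                    (ℕ.≤-trans (ℕ.+-monoʳ-≤ (deficiency G T) le)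
                      (ℕ.≤-reflexive (ℕ.m+[n∸m]≡n (ℕ.m+n≤o⇒n≤o (deficiency G S) lo)))))
                  (ℕ.≤-trans (ℕ.∸-monoˡ-≤ (length ys) m≤) (ℕ.≤-reflexive (ℕ.m+n∸m≡n (length ys) (length zs))))))
  deficiency-cover (join {ys = ys} S T between ys≤zs p) m lo hi = cover-↭ p
    (cover-join between (deficiency G T) (deficiency≤length G T) ys≤zs (deficiency-cover T) m lo
      (subst (m ≤_) (≡.trans (↭-length p) (List.length-++ ys)) hi))

  -- The root of a tree inside a piece will also lie in the block that the piece closes up to, so it
  -- carries at most one block below. The hub vertex has no block above it and may carry two.
  data Hub : List (Fin n) → Set where
    hub₁ : ∀ v {a b} → adj G v a ≡ true → adj G v b ≡ true → (p : Piece a b) → Hub (v ∷ verts p)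
    hub₂ : ∀ v {a b c d} → adj G v a ≡ true → adj G v b ≡ true → (p : Piece a b) →
           adj G v c ≡ true → adj G v d ≡ true → (q : Piece c d) → Hub (v ∷ verts p ++ verts q)

  -- Start from `s ⊔ d = s + e` pieces of `zs`, where `e ≤ s` by the bound on the deficiency. The
  -- `s ∸ 1` vertices of `as` reduce these to one piece if `e < s`. If `e = s`, all of them save two
  -- and two pieces remain, which `a` closes on its two sides.
  join-hub : ∀ {ys zs} → 1 ≤ length ys → (T : Cotree G zs) → Between G true ys zs → length ys ≤ length zs →
             deficiency G T ≤ 2 * length ys → ∃ λ vs → Hub vs × vs ↭ ys ++ zs
  join-hub {a ∷ as} {zs} _ T between ys≤zs d≤2s
    with deficiency-cover T (s ⊔ d) (ℕ.m≤n⊔m s d) (ℕ.⊔-lub ys≤zs (deficiency≤length G T))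
    where
    s = suc (length as)
    d = deficiency G T
  ... | ps , len , perm = go e (≡.trans len (≡.sym (ℕ.m+[n∸m]≡n (ℕ.m≤m⊔n s d)))) (ℕ.m≤n⇒m<n∨m≡n e≤s)
    where
    s = suc (length as)
    d = deficiency G T
    e = s ⊔ d ∸ s
    e≤s : e ≤ s
    e≤s = ℕ.≤-trans (ℕ.∸-monoˡ-≤ s (ℕ.⊔-lub (ℕ.m≤m+n s (s + 0)) d≤2s))
      (ℕ.≤-reflexive (≡.trans (ℕ.m+n∸m≡n s (s + 0)) (ℕ.+-identityʳ s)))
    ends : All (EndsIn zs) ps
    ends = ends-in ps (∈-resp-↭ perm)
    go : ∀ e → length ps ≡ s + e → e < s ⊎ e ≡ s → ∃ λ vs → Hub vs × vs ↭ (a ∷ as) ++ zs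
    go e len (inj₁ (s≤s e≤)) with merge as 0 e ps (between ∘ there) ends len e≤
    ... | p ∷ [] , refl , (p₁ , p₂) ∷ [] , perm′ = _ ,
        hub₁ a (between (here refl) p₁) (between (here refl) p₂) (body p) ,
        prep a (↭-trans (↭-reflexive (≡.sym (List.++-identityʳ _))) (↭-trans perm′ (Perm.++⁺ˡ as perm)))
    go _ len (inj₂ refl)
      with merge as 1 (length as) ps (between ∘ there) ends (≡.trans len (ℕ.+-suc s (length as))) ℕ.≤-refl
    ... | p ∷ q ∷ [] , refl , (p₁ , p₂) ∷ (q₁ , q₂) ∷ [] , perm′ = _ ,
        hub₂ a (between (here refl) p₁) (between (here refl) p₂) (body p)
               (between (here refl) q₁) (between (here refl) q₂) (body q) ,
        prep a (↭-trans (↭-reflexive (cong (verts (body p) ++_) (≡.sym (List.++-identityʳ _))))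
          (↭-trans perm′ (Perm.++⁺ˡ as perm)))

-- The blocks of a tree of cycles

linked-lookup : ∀ {A : Set} {R : A → A → Set} {xs} → Linked R xs → ∀ i j → toℕ j ≡ suc (toℕ i) →
                R (List.lookup xs i) (List.lookup xs j)
linked-lookup [-] zero zero ()
linked-lookup (r ∷ rs) zero zero ()
linked-lookup (r ∷ rs) zero (suc zero) eq = r
linked-lookup (r ∷ rs) zero (suc (suc j)) ()
linked-lookup (r ∷ rs) (suc i) zero ()
linked-lookup (r ∷ rs) (suc i) (suc j) eq = linked-lookup rs i j (ℕ.suc-injective eq)

module _ {n : ℕ} (G : Graph n) where

  record GoodCycle (c : List (Fin n)) : Set where
    constructor good-cycle
    field
      {half} : ℕ
      even : length c ≡ 2 * suc half
      edges : ∀ i j → CycAdj (length c) i j → adj G (List.lookup c i) (List.lookup c j) ≡ true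

  roots : ∀ {a b} → Piece G a b → List (Fin n)
  roots (one {a} t) = a ∷ []
  roots (chain {a} {b} s _ t _ p) = a ∷ b ∷ roots p

  subtrees : ∀ {a b} → Piece G a b → List (Fin n)
  subtrees (one t) = below G t
  subtrees (chain s _ t _ p) = below G s ++ below G t ++ subtrees p

  verts-↭ : ∀ {a b} (p : Piece G a b) → verts G p ↭ roots p ++ subtrees p
  verts-↭ (one t) = ↭-refl
  verts-↭ (chain {a} {b} s _ t _ p) = prep a (↭-trans
      (Perm.++⁺ˡ (below G s) (prep b (Perm.++⁺ˡ (below G t) (verts-↭ p))))
      (rearrange (below G s) (below G t) (roots p) (subtrees p)))
    where
    rearrange : ∀ ss ts rs us → ss ++ b ∷ ts ++ rs ++ us ↭ b ∷ rs ++ ss ++ ts ++ us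
    rearrange ss ts rs us = prove 5 (vs ⊕ (vb ⊕ (vt ⊕ (vr ⊕ vu)))) (vb ⊕ (vr ⊕ (vs ⊕ (vt ⊕ vu))))
      (ss ∷ [ b ] ∷ ts ∷ rs ∷ us ∷ [])
      where
      open import Algebra.Solver.CommutativeMonoid (++-commutativeMonoid {A = Fin n})
      vs = var (# 0) ; vb = var (# 1) ; vt = var (# 2) ; vr = var (# 3) ; vu = var (# 4)

  roots-odd : ∀ {a b} (p : Piece G a b) → ∃ λ m → suc (length (roots p)) ≡ 2 * suc m
  roots-odd (one t) = 0 , refl
  roots-odd (chain s _ t _ p) with roots-odd p
  ... | m , eq = suc m , cong suc (≡.trans (cong suc eq) (≡.sym (ℕ.+-suc (suc m) (suc (m + 0)))))

  roots-linked : ∀ {v a b} → adj G v a ≡ true → (p : Piece G a b) → Linked (λ u w → adj G u w ≡ true) (v ∷ roots p)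
  roots-linked va (one t) = va ∷ [-]
  roots-linked va (chain s ab t bc p) = va ∷ ab ∷ roots-linked bc p

  roots-last : ∀ {a b} (p : Piece G a b) i → suc (toℕ i) ≡ length (roots p) → List.lookup (roots p) i ≡ b
  roots-last (one t) zero _ = refl
  roots-last (chain s _ t _ (one _)) zero ()
  roots-last (chain s _ t _ (chain _ _ _ _ _)) zero ()
  roots-last (chain s _ t _ (one _)) (suc zero) ()
  roots-last (chain s _ t _ (chain _ _ _ _ _)) (suc zero) ()
  roots-last (chain s _ t _ p) (suc (suc i)) eq = roots-last p i (ℕ.suc-injective (ℕ.suc-injective eq))

  node-cycle : ∀ {v a b} → adj G v a ≡ true → adj G v b ≡ true → (p : Piece G a b) → GoodCycle (v ∷ roots p)
  node-cycle {v} va vb p = good-cycle (proj₂ (roots-odd p)) edges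
    where
    edges : ∀ i j → CycAdj (suc (length (roots p))) i j →
            adj G (List.lookup (v ∷ roots p) i) (List.lookup (v ∷ roots p) j) ≡ true
    edges i j (inj₁ eq) = linked-lookup (roots-linked va p) i j eq
    -- Index zero could be the last one only if there were no roots, but their number is odd.
    edges zero zero (inj₂ (eq , _)) with roots-odd p
    ... | m , odd with () ← ≡.trans eq (≡.trans (ℕ.suc-injective odd) (ℕ.+-suc m _))
    -- Here `i` is the position of the last root, which is `b`, so the wrap-around pair is the edge
    -- `vb` reversed.
    edges (suc i) zero (inj₂ (eq , _)) = ≡.trans (Defs.sym G _ _)
      (subst (λ w → adj G v w ≡ true) (≡.sym (roots-last p i eq)) vb)

  -- Glued vs slots bs: the cyclic lists bs are glued at single vertices in the form of a tree
  -- covering vs; the slots are the vertices at which one more cyclic list may still be attached.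
  data Glued : List (Fin n) → List (Fin n) → List (List (Fin n)) → Set where
    start : ∀ {c} → GoodCycle c → Glued c c (c ∷ [])
    attach : ∀ {vs slots bs h} tail → GoodCycle (h ∷ tail) → Glued vs (h ∷ slots) bs →
             Glued (tail ++ vs) (tail ++ slots) ((h ∷ tail) ∷ bs)
    skip : ∀ {vs slots bs h} → Glued vs (h ∷ slots) bs → Glued vs slots bs

  -- The slots act as a stack: the tree at the top slot is glued completely, its own roots being
  -- pushed and consumed, before the next slot is served.
  glue-tree : ∀ {v vs slots bs} (t : Tree G v) → Glued vs (v ∷ slots) bs →
              ∃₂ λ vs′ bs′ → Glued vs′ slots bs′ × vs′ ↭ below G t ++ vs
  glue-piece : ∀ {a b vs slots bs} (p : Piece G a b) → Glued vs (roots p ++ slots) bs →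
               ∃₂ λ vs′ bs′ → Glued vs′ slots bs′ × vs′ ↭ subtrees p ++ vs
  glue-tree (leaf v) g = _ , _ , skip g , ↭-refl
  glue-tree {vs = vs} (node v va vb p) g with glue-piece p (attach (roots p) (node-cycle va vb p) g)
  ... | vs′ , bs′ , g′ , perm = vs′ , bs′ , g′ , ↭-trans perm (↭-trans (Perm.shifts (subtrees p) (roots p))
      (↭-trans (↭-reflexive (≡.sym (List.++-assoc (roots p) (subtrees p) vs))) (Perm.++⁺ʳ vs (↭-sym (verts-↭ p)))))
  glue-piece (one t) g = glue-tree t g
  glue-piece {vs = vs} (chain s _ t _ p) g with glue-tree s g
  ... | _ , _ , g₁ , perm₁ with glue-tree t g₁
  ... | _ , _ , g₂ , perm₂ with glue-piece p g₂
  ... | _ , _ , g₃ , perm₃ = _ , _ , g₃ , ↭-trans perm₃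
      (↭-trans (Perm.++⁺ˡ (subtrees p) (↭-trans perm₂ (Perm.++⁺ˡ (below G t) perm₁)))
        (rearrange (subtrees p) (below G t) (below G s)))
    where
    rearrange : ∀ ps ts ss → ps ++ ts ++ ss ++ vs ↭ (ss ++ ts ++ ps) ++ vs
    rearrange ps ts ss = prove 4 (p′ ⊕ (t′ ⊕ (s′ ⊕ v′))) ((s′ ⊕ (t′ ⊕ p′)) ⊕ v′) (ps ∷ ts ∷ ss ∷ vs ∷ [])
      where
      open import Algebra.Solver.CommutativeMonoid (++-commutativeMonoid {A = Fin n})
      p′ = var (# 0) ; t′ = var (# 1) ; s′ = var (# 2) ; v′ = var (# 3)

  -- With one piece the slot of `v` is given up; with two pieces it is spent on the second list, so
  -- that `v` lies in both.
  glue-hub : ∀ {vs} → Hub G vs → ∃₂ λ vs′ bs → Glued vs′ [] bs × vs′ ↭ vs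
  glue-hub (hub₁ v va vb p)
    with glue-piece p (subst (λ slots → Glued (v ∷ roots p) slots ((v ∷ roots p) ∷ []))
           (≡.sym (List.++-identityʳ (roots p))) (skip (start (node-cycle va vb p))))
  ... | _ , _ , g , perm = _ , _ , g , ↭-trans perm (↭-trans (Perm.shift v (subtrees p) (roots p))
      (prep v (↭-trans (Perm.++-comm (subtrees p) (roots p)) (↭-sym (verts-↭ p)))))
  glue-hub (hub₂ v va vb p vc vd q)
    with glue-piece q (attach (roots q) (node-cycle vc vd q)
           (subst (λ slots → Glued (v ∷ roots p) (v ∷ slots) ((v ∷ roots p) ∷ []))
             (≡.sym (List.++-identityʳ (roots p))) (start (node-cycle va vb p))))
  ... | _ , _ , g , perm with glue-piece p g
  ... | _ , _ , g′ , perm′ = _ , _ , g′ , ↭-trans perm′ (↭-trans (Perm.++⁺ˡ (subtrees p) perm)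
      (↭-trans (rearrange (subtrees p) (subtrees q) (roots q) (roots p))
        (prep v (↭-sym (Perm.++⁺ (verts-↭ p) (verts-↭ q))))))
    where
    rearrange : ∀ ps qs rq rp → ps ++ qs ++ rq ++ v ∷ rp ↭ v ∷ (rp ++ ps) ++ (rq ++ qs)
    rearrange ps qs rq rp = prove 5 (vps ⊕ (vqs ⊕ (vrq ⊕ (vv ⊕ vrp)))) (vv ⊕ ((vrp ⊕ vps) ⊕ (vrq ⊕ vqs)))
      (ps ∷ qs ∷ rq ∷ rp ∷ [ v ] ∷ [])
      where
      open import Algebra.Solver.CommutativeMonoid (++-commutativeMonoid {A = Fin n})
      vps = var (# 0) ; vqs = var (# 1) ; vrq = var (# 2) ; vrp = var (# 3) ; vv = var (# 4)

  slots⊆ : ∀ {vs slots bs} → Glued vs slots bs → ∀ {v} → v ∈ slots → v ∈ vs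
  slots⊆ (start _) p = p
  slots⊆ (attach tail _ g) p with ∈-++⁻ tail p
  ... | inj₁ q = ∈-++⁺ˡ q
  ... | inj₂ q = ∈-++⁺ʳ tail (slots⊆ g (there q))
  slots⊆ (skip g) p = slots⊆ g (there p)

  blocks⊆ : ∀ {vs slots bs} → Glued vs slots bs → ∀ {c v} → c ∈ bs → v ∈ c → v ∈ vs
  blocks⊆ (start _) (here refl) q = q
  blocks⊆ (attach tail _ g) (here refl) (here refl) = ∈-++⁺ʳ tail (slots⊆ g (here refl))
  blocks⊆ (attach tail _ g) (here refl) (there q) = ∈-++⁺ˡ q
  blocks⊆ (attach tail _ g) (there p) q = ∈-++⁺ʳ tail (blocks⊆ g p q)
  blocks⊆ (skip g) p q = blocks⊆ g p q

  blocks-good : ∀ {vs slots bs} → Glued vs slots bs → ∀ {c} → c ∈ bs → GoodCycle c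
  blocks-good (start gc) (here refl) = gc
  blocks-good (attach tail gc g) (here refl) = gc
  blocks-good (attach tail gc g) (there p) = blocks-good g p
  blocks-good (skip g) p = blocks-good g p

  blocks-unique : ∀ {vs slots bs} → Glued vs slots bs → Unique vs → ∀ {c} → c ∈ bs → Unique c
  blocks-unique (start _) u (here refl) = u
  blocks-unique (attach tail _ g) u (here refl) =
    All.tabulate (λ p eq → unique-disjoint tail u p (subst (_∈ _) eq (slots⊆ g (here refl)))) ∷ unique-++ˡ tail u
  blocks-unique (attach tail _ g) u (there p) = blocks-unique g (unique-++ʳ tail u) p
  blocks-unique (skip g) u p = blocks-unique g u p

  slots-unique : ∀ {vs slots bs} → Glued vs slots bs → Unique vs → Unique slots
  slots-unique (start _) u = u
  slots-unique (attach {slots = slots} tail _ g) u with slots-unique g (unique-++ʳ tail u)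
  ... | _ ∷ us = AllPairs.++⁺ (unique-++ˡ tail u) us
      (All.tabulate λ p → All.tabulate λ { q refl → unique-disjoint tail u p (slots⊆ g (there q)) })
  slots-unique (skip g) u with slots-unique g u
  ... | _ ∷ us = us

  -- The invariant behind the bound of two blocks per vertex. Attaching at `h` removes `h` from the
  -- slots, the vertices of `tail` are new and lie only in the new list, and the remaining slots are
  -- not in `h ∷ tail`.
  slot-block : ∀ {vs slots bs} → Glued vs slots bs → Unique vs → ∀ {v c d} → v ∈ slots →
               c ∈ bs → d ∈ bs → v ∈ c → v ∈ d → c ≡ d
  slot-block (start _) u _ (here refl) (here refl) _ _ = refl
  slot-block (attach tail _ g) u v∈ (here refl) (here refl) _ _ = refl
  slot-block (attach {slots = slots} {bs} {h} tail _ g) u {v} {c} {d} v∈ c∈ d∈ p q with ∈-++⁻ tail v∈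
  ... | inj₁ v∈tail = fresh c∈ d∈
    where
    fresh : c ∈ (h ∷ tail) ∷ bs → d ∈ (h ∷ tail) ∷ bs → c ≡ d
    fresh (there c∈) _ = contradiction (blocks⊆ g c∈ p) (unique-disjoint tail u v∈tail)
    fresh _ (there d∈) = contradiction (blocks⊆ g d∈ q) (unique-disjoint tail u v∈tail)
    fresh (here refl) (here refl) = refl
  ... | inj₂ v∈slots = old c∈ d∈
    where
    u′ : Unique _
    u′ = unique-++ʳ tail u
    not-new : v ∉ h ∷ tail
    not-new (here refl) with slots-unique g u′
    ... | h∉ ∷ _ = All.lookup h∉ v∈slots refl
    not-new (there r) = unique-disjoint tail u r (slots⊆ g (there v∈slots))
    old : c ∈ (h ∷ tail) ∷ bs → d ∈ (h ∷ tail) ∷ bs → c ≡ d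
    old (here refl) _ = contradiction p not-new
    old _ (here refl) = contradiction q not-new
    old (there c∈) (there d∈) = slot-block g u′ (there v∈slots) c∈ d∈ p q
  slot-block (skip g) u v∈ = slot-block g u (there v∈)

  -- A new list gives `h` one more list; being a slot, `h` was in at most one before. The vertices
  -- of `tail` occur in no older list.
  at-most-two-blocks : ∀ {vs slots bs} → Glued vs slots bs → Unique vs → ∀ {v c d e} →
                       c ∈ bs → d ∈ bs → e ∈ bs → v ∈ c → v ∈ d → v ∈ e → c ≡ d ⊎ c ≡ e ⊎ d ≡ e
  at-most-two-blocks (start _) u (here refl) (here refl) _ _ _ _ = inj₁ refl
  at-most-two-blocks (skip g) u = at-most-two-blocks g u
  at-most-two-blocks (attach {vs} {bs = bs} {h} tail _ g) u {v} = go
    where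
    u′ : Unique vs
    u′ = unique-++ʳ tail u
    old : ∀ {c d} → v ∈ h ∷ tail → c ∈ bs → d ∈ bs → v ∈ c → v ∈ d → c ≡ d
    old (here refl) c∈ d∈ p q = slot-block g u′ (here refl) c∈ d∈ p q
    old (there r) c∈ d∈ p q = contradiction (blocks⊆ g c∈ p) (unique-disjoint tail u r)
    go : ∀ {c d e} → c ∈ (h ∷ tail) ∷ bs → d ∈ (h ∷ tail) ∷ bs → e ∈ (h ∷ tail) ∷ bs →
         v ∈ c → v ∈ d → v ∈ e → c ≡ d ⊎ c ≡ e ⊎ d ≡ e
    go (here refl) (here refl) _ _ _ _ = inj₁ refl
    go (here refl) (there _) (here refl) _ _ _ = inj₂ (inj₁ refl)
    go (there _) (here refl) (here refl) _ _ _ = inj₂ (inj₂ refl)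
    go (here refl) (there d∈) (there e∈) p q r = inj₂ (inj₂ (old p d∈ e∈ q r))
    go (there c∈) (here refl) (there e∈) p q r = inj₂ (inj₁ (old q c∈ e∈ p r))
    go (there c∈) (there d∈) (here refl) p q r = inj₁ (old r c∈ d∈ p q)
    go (there c∈) (there d∈) (there e∈) p q r = at-most-two-blocks g u′ c∈ d∈ e∈ p q r

  AnyPair : List (List (Fin n)) → Fin n → Fin n → Set
  AnyPair bs u v = Any (λ c → CycPair c u v) bs

  module _ {B : SubG n} (B-WF : WF B) (B-nonsep : Nonseparable B) where

    private
      B-irr : ∀ {v} → ¬ T (E B v v)
      B-irr {v} p = subst T (proj₁ (proj₂ B-WF) v) p

    -- The last list `h ∷ tail` meets the older part only in `h`. If `B` had a vertex in `tail` and
    -- another outside `h ∷ tail`, deleting `h` would disconnect it, or it would be disconnected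
    -- already if it avoids `h`. So `B` lies on one side, and an edge of `B` coming from the other
    -- side would be a loop at `h`.
    nonseparable-in-block : ∀ {vs slots bs} → Glued vs slots bs → Unique vs →
      (∀ v → T (V B v) → v ∈ vs) → (∀ u v → T (E B u v) → AnyPair bs u v) →
      ∃ λ c → c ∈ bs × (∀ v → T (V B v) → v ∈ c) × (∀ u v → T (E B u v) → CycPair c u v)
    nonseparable-in-block (start {c} _) u B⊆ E⊆ = c , here refl , B⊆ , λ u v e → only (E⊆ u v e)
      where
      only : ∀ {u v} → AnyPair (c ∷ []) u v → CycPair c u v
      only (here p) = p
    nonseparable-in-block (skip g) u = nonseparable-in-block g u
    nonseparable-in-block (attach {vs} {bs = bs} {h} tail _ g) u B⊆ E⊆
      with Fin.any? (λ v → T? (V B v) ×-dec (v ∈? tail))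
         | Fin.any? (λ v → T? (V B v) ×-dec ¬? (v ∈? (h ∷ tail)))
    ... | no none | _ =
        let c , c∈ , V⊆ , E⊆c = nonseparable-in-block g (unique-++ʳ tail u) old-vertex
                                  (λ u v e → old-edge e (E⊆ u v e))
        in c , there c∈ , V⊆ , E⊆c
      where
      old-vertex : ∀ v → T (V B v) → v ∈ vs
      old-vertex v p with ∈-++⁻ tail (B⊆ v p)
      ... | inj₁ q = contradiction (v , p , q) none
      ... | inj₂ q = q
      is-h : ∀ {v} → T (V B v) → v ∈ h ∷ tail → v ≡ h
      is-h p (here eq) = eq
      is-h p (there q) = contradiction (_ , p , q) none
      old-edge : ∀ {u v} → T (E B u v) → AnyPair ((h ∷ tail) ∷ bs) u v → AnyPair bs u v
      old-edge e (there q) = q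
      old-edge {u} {v} e (here q) with proj₂ (proj₂ B-WF) u v e | cycPair-∈ q
      ... | p₁ , p₂ | q₁ , q₂ with is-h p₁ q₁ | is-h p₂ q₂
      ... | refl | refl = contradiction e B-irr
    ... | yes _ | no none = h ∷ tail , here refl , new-vertex , λ u v e → new-edge e (E⊆ u v e)
      where
      new-vertex : ∀ v → T (V B v) → v ∈ h ∷ tail
      new-vertex v p = decidable-stable (v ∈? (h ∷ tail)) λ q → none (v , p , q)
      is-h : ∀ {v} → T (V B v) → v ∈ vs → v ≡ h
      is-h p q with new-vertex _ p
      ... | here eq = eq
      ... | there r = contradiction q (unique-disjoint tail u r)
      new-edge : ∀ {u v} → T (E B u v) → AnyPair ((h ∷ tail) ∷ bs) u v → CycPair (h ∷ tail) u v
      new-edge e (here q) = q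
      new-edge {u} {v} e (there q) with proj₂ (proj₂ B-WF) u v e | find q
      ... | p₁ , p₂ | c , c∈ , r
        with is-h p₁ (blocks⊆ g c∈ (proj₁ (cycPair-∈ r))) | is-h p₂ (blocks⊆ g c∈ (proj₂ (cycPair-∈ r)))
      ... | refl | refl = contradiction e B-irr
    ... | yes (y , y∈B , y∈tail) | yes (z , z∈B , z∉) = contradiction (there (cut-reach (T? (V B h)))) z∉
      where
      stays : ∀ {a b} → T (E B a b) → b ≢ h → a ∈ tail → b ∈ tail
      stays e b≢h a∈ with E⊆ _ _ e
      ... | there q = let c , c∈ , r = find q in
            contradiction (blocks⊆ g c∈ (proj₁ (cycPair-∈ r))) (unique-disjoint tail u a∈)
      ... | here q with proj₂ (cycPair-∈ q)
      ...   | here eq = contradiction eq b≢h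
      ...   | there r = r
      y≢h : y ≢ h
      y≢h refl = unique-disjoint tail u y∈tail (slots⊆ g (here refl))
      cut-reach : Dec (T (V B h)) → z ∈ tail
      cut-reach (yes h∈B) = reach-closed (_∈ tail)
        (λ a b _ q e → stays (-v-E⁻ B h e) (proj₂ (-v-V⁻ B h q)))
        (proj₂ (proj₂ B-nonsep) h h∈B y z (-v-V⁺ B h y∈B y≢h) (-v-V⁺ B h z∈B (z∉ ∘ here))) y∈tail
      cut-reach (no h∉B) = reach-closed (_∈ tail)
        (λ a b _ q e → stays e (λ { refl → h∉B q }))
        (proj₁ (proj₂ B-nonsep) y z y∈B z∈B) y∈tail

  good-nonseparable : ∀ {c} → GoodCycle c → Unique c → WF (cyc c) × Nonseparable (cyc c)
  good-nonseparable {[]} (good-cycle () _) u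
  good-nonseparable {_ ∷ []} (good-cycle {half} eq _) u with () ← ≡.trans (ℕ.suc-injective eq) (ℕ.+-suc half (half + 0))
  good-nonseparable {_ ∷ _ ∷ _} _ u = cyc-WF u , cyc-nonseparable u

  glued-connected : ∀ {C : SubG n} → (∀ v → T (V C v)) → (∀ u v → T (E C u v) → T (E C v u)) →
    ∀ {vs slots bs} → Glued vs slots bs → Unique vs → (∀ {u v} → AnyPair bs u v → T (E C u v)) →
    ∀ {u v} → u ∈ vs → v ∈ vs → Reach C u v
  glued-connected {C} all-V E-sym (start gc) u E⊆ p q =
    reach-map (λ v _ → all-V v) (λ _ _ _ _ e → E⊆ (here (cyc-E⁻ e)))
      (proj₁ (proj₂ (proj₂ (good-nonseparable gc u))) _ _ (cyc-V⁺ p) (cyc-V⁺ q))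
  glued-connected all-V E-sym (skip g) u E⊆ = glued-connected all-V E-sym g u E⊆
  glued-connected {C} all-V E-sym G′@(attach {vs} {h = h} tail gc g) u E⊆ p q =
      reach-trans (to-h p) (reach-sym E-sym (to-h q))
    where
    to-h : ∀ {w} → w ∈ tail ++ vs → Reach C w h
    to-h r with ∈-++⁻ tail r
    ... | inj₁ w∈ = reach-map (λ v _ → all-V v) (λ _ _ _ _ e → E⊆ (here (cyc-E⁻ e)))
        (proj₁ (proj₂ (proj₂ (good-nonseparable gc (blocks-unique G′ u (here refl))))) _ _
          (cyc-V⁺ (there w∈)) (cyc-V⁺ (here refl)))
    ... | inj₂ w∈ = glued-connected all-V E-sym g (unique-++ʳ tail u) (E⊆ ∘ there) w∈ (slots⊆ g (here refl))

  cyc-classify : ∀ {B c} → B ≈ cyc c → GoodCycle c → Unique c → IsEvenCycle B ⊎ IsSingleEdge B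
  cyc-classify {B} {x ∷ y ∷ []} (V≈ , E≈) (good-cycle {zero} eq _) ((x≢y ∷ []) ∷ _) =
      inj₂ (x , y , x≢y , (λ v → mk⇔ (ends ∘ cyc-V⁻ ∘ subst T (V≈ v)) (subst T (≡.sym (V≈ v)) ∘ cyc-V⁺ ∘ ends⁻)) ,
        λ u v → mk⇔ (cycPair-edge ∘ cyc-E⁻ ∘ subst T (E≈ u v)) (subst T (≡.sym (E≈ u v)) ∘ cyc-E⁺ ∘ pair))
    where
    ends : ∀ {v} → v ∈ x ∷ y ∷ [] → v ≡ x ⊎ v ≡ y
    ends (here eq) = inj₁ eq
    ends (there (here eq)) = inj₂ eq
    ends⁻ : ∀ {v} → v ≡ x ⊎ v ≡ y → v ∈ x ∷ y ∷ []
    ends⁻ (inj₁ eq) = here eq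
    ends⁻ (inj₂ eq) = there (here eq)
    pair : ∀ {u v} → (u ≡ x × v ≡ y) ⊎ (u ≡ y × v ≡ x) → CycPair (x ∷ y ∷ []) u v
    pair (inj₁ (refl , refl)) = cyc-pair zero (suc zero) (inj₁ refl) (inj₁ (refl , refl))
    pair (inj₂ (refl , refl)) = cyc-pair zero (suc zero) (inj₁ refl) (inj₂ (refl , refl))
  cyc-classify {B} {c} (V≈ , E≈) (good-cycle {suc m} eq _) u = inj₁ (m , indexed eq)
    where
    -- The length is generalised to `k` so that the equation with `2 * (2 + m)` can be matched with
    -- `refl`.
    indexed : ∀ {k} → length c ≡ k → Σ (Fin k → Fin n) λ f → Injective f
      × (∀ v → T (V B v) ⇔ (∃ λ i → f i ≡ v))
      × (∀ u v → T (E B u v) ⇔ (∃ λ i → ∃ λ j → CycAdj k i j × ((f i ≡ u × f j ≡ v) ⊎ (f i ≡ v × f j ≡ u))))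
    indexed refl = List.lookup c , lookup-injective u ,
      (λ v → mk⇔ (λ p → let v∈ = cyc-V⁻ (subst T (V≈ v) p) in Any.index v∈ , ≡.sym (lookup-index v∈))
                 (λ { (i , refl) → subst T (≡.sym (V≈ v)) (cyc-V⁺ (∈-lookup i)) })) ,
      (λ u v → mk⇔ (λ p → unpair (cyc-E⁻ (subst T (E≈ u v) p)))
                   (λ (i , j , a , p) → subst T (≡.sym (E≈ u v)) (cyc-E⁺ (cyc-pair i j a p))))
      where
      unpair : ∀ {u v} → CycPair c u v → _
      unpair (cyc-pair i j a p) = i , j , a , p

  module _ {vs slots : List (Fin n)} {bs : List (List (Fin n))} 
           (glued : Glued vs slots bs) (perm : vs ↭ List.allFin n) where

    private
      unique : Unique vs
      unique = unique-resp-↭ (↭-sym perm) (allFin⁺ n)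

      covers : ∀ v → v ∈ vs
      covers v = ∈-resp-↭ (↭-sym perm) (∈-allFin v)

      anyPair? : ∀ u v → Dec (AnyPair bs u v)
      anyPair? u v = any? (λ c → cycPair? c u v) bs

      H : SubG n
      H = mkSubG (λ _ → true) (λ u v → ⌊ anyPair? u v ⌋)

      H⁺ : ∀ {u v} → AnyPair bs u v → T (E H u v)
      H⁺ {u} {v} = fromWitness {a? = anyPair? u v}

      H⁻ : ∀ {u v} → T (E H u v) → AnyPair bs u v
      H⁻ {u} {v} = toWitness {a? = anyPair? u v}

      H-sym : ∀ u v → T (E H u v) → T (E H v u)
      H-sym u v e = H⁺ (Any.map cycPair-sym (H⁻ {u} {v} e))

      block-good : ∀ {c} → c ∈ bs → GoodCycle c
      block-good = blocks-good glued

      block-unique : ∀ {c} → c ∈ bs → Unique c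
      block-unique = blocks-unique glued unique

      H-adj : ∀ u v → T (E H u v) → T (adj G u v)
      H-adj u v e with find (H⁻ {u} {v} e)
      ... | c , c∈ , cyc-pair i j a (inj₁ (refl , refl)) = ≡true⇒T (GoodCycle.edges (block-good c∈) i j a)
      ... | c , c∈ , cyc-pair i j a (inj₂ (refl , refl)) = 
          ≡true⇒T (≡.trans (Defs.sym G u v) (GoodCycle.edges (block-good c∈) i j a))

      H-WF : WF H
      H-WF = (λ u v → T-ext (H-sym u v) (H-sym v u)) ,
        (λ v → Bool.¬-not λ p → contradiction (≡.trans (≡.sym (T⇒≡true (H-adj v v (≡true⇒T p)))) (irr G v)) λ ()) ,
        (λ _ _ _ → tt , tt)

      -- Nonseparability puts `B` inside the graph of a single list. That graph is itself
      -- nonseparable, so the maximality of `B` turns the inclusion into equality.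
      block-is-cyc : ∀ B → IsBlock H B → ∃ λ c → c ∈ bs × B ≈ cyc c
      block-is-cyc B (B-WF , B⊑H , B-nonsep , maximal) =
        let c , c∈ , V⊆ , E⊆ = nonseparable-in-block B-WF B-nonsep glued unique (λ v _ → covers v)
                                 (λ u v e → H⁻ {u} {v} (proj₂ B⊑H u v e))
            c-WF , c-nonsep = good-nonseparable (block-good c∈) (block-unique c∈)
            V⊇ , E⊇ = maximal (cyc c) c-WF ((λ _ _ → tt) , λ u v e → H⁺ {u} {v} (lose c∈ (cyc-E⁻ e))) c-nonsep
                        ((λ v p → cyc-V⁺ (V⊆ v p)) , (λ u v e → cyc-E⁺ (E⊆ u v e)))
        in c , c∈ , (λ v → T-ext (cyc-V⁺ ∘ V⊆ v) (V⊇ v)) , (λ u v → T-ext (cyc-E⁺ ∘ E⊆ u v) (E⊇ u v))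

      ≈⇒¬Distinct : ∀ {B C : SubG n} → B ≈ C → ¬ Distinct B C
      ≈⇒¬Distinct (p , _) (inj₁ (v , ne)) = ne (p v)
      ≈⇒¬Distinct (_ , q) (inj₂ (u , v , ne)) = ne (q u v)

      same-cyc : ∀ {B C c d} → B ≈ cyc c → C ≈ cyc d → c ≡ d → ¬ Distinct B C
      same-cyc p q refl = ≈⇒¬Distinct (≈-trans p (≈-sym q))

    glued-SBEP : HasSpanningSBEP G
    glued-SBEP = H , H-WF , (λ _ → tt) , ((λ _ _ → tt) , H-adj) ,
      (λ u v _ _ → glued-connected (λ _ → tt) H-sym glued unique (λ {u} {v} → H⁺ {u} {v}) (covers u) (covers v)) ,
      (λ B block → let c , c∈ , B≈ = block-is-cyc B block in cyc-classify B≈ (block-good c∈) (block-unique c∈)) ,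
      λ v B₁ B₂ B₃ b₁ b₂ b₃ p₁ p₂ p₃ d₁₂ d₁₃ d₂₃ →
        let c₁ , c₁∈ , e₁ = block-is-cyc B₁ b₁
            c₂ , c₂∈ , e₂ = block-is-cyc B₂ b₂
            c₃ , c₃∈ , e₃ = block-is-cyc B₃ b₃
        in Sum.[ (λ eq → same-cyc e₁ e₂ eq d₁₂) , Sum.[ (λ eq → same-cyc e₁ e₃ eq d₁₃) , (λ eq → same-cyc e₂ e₃ eq d₂₃) ] ]
             (at-most-two-blocks glued unique c₁∈ c₂∈ c₃∈ (cyc-V⁻ (subst T (proj₁ e₁ v) p₁))
               (cyc-V⁻ (subst T (proj₁ e₂ v) p₂)) (cyc-V⁻ (subst T (proj₁ e₃ v) p₃)))

-- Spanning SBEP subgraphs of tough connected cographs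

module _ {n : ℕ} (G : Graph n) (2≤n : 2 ≤ n) (connected : GraphConnected G) (tough : IsTough G 1 2) where

  cotree-SBEP : ∀ {xs} → Cotree G xs → xs ≡ List.allFin n → HasSpanningSBEP G
  cotree-SBEP (leaf v) eq = contradiction 2≤n (ℕ.<⇒≱ (s≤s (ℕ.≤-reflexive
    (≡.trans (≡.sym (List.length-tabulate {n = n} (λ i → i))) (cong length (≡.sym eq))))))
  cotree-SBEP (union {ys = ys} {zs} S T′ between p) refl
    with nonempty G (cotree-nonempty G S) | nonempty G (cotree-nonempty G T′)
  ... | y , y∈ | z , z∈ = contradiction z∈ (unique-disjoint ys (unique-resp-↭ p (allFin⁺ n)) stuck)
    where
    stays : ∀ u w → T (adj G u w) → u ∈ ys → w ∈ ys
    stays u w e u∈ with ∈-++⁻ ys (∈-resp-↭ p (∈-allFin w))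
    ... | inj₁ w∈ = w∈
    ... | inj₂ w∈ = ⊥-elim (subst T (between u∈ w∈) e)
    stuck : z ∈ ys
    stuck = reach-closed (_∈ ys) (λ u w _ _ → stays u w) (connected y z tt tt) y∈
  cotree-SBEP (join {ys = ys} {zs} S T′ between ys≤zs p) refl =
    let vs , hub , perm = join-hub G ys≥1 T′ between ys≤zs (ℕ.≮⇒≥ excess)
        vs′ , bs , glued , perm′ = glue-hub G hub
    in glued-SBEP G glued (↭-trans perm′ (↭-trans perm (↭-sym p)))
    where
    ys≥1 : 1 ≤ length ys
    ys≥1 = cotree-nonempty G S
    -- If the deficiency of `zs` exceeded `2 * length ys`, deleting `ys` along with a deficient cut
    -- of `zs` would leave more than twice as many components as deleted vertices. At least two
    -- remain because `ys` is nonempty, so toughness applies.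
    excess : ¬ 2 * length ys < deficiency G T′
    excess gt with deficient-cut G T′
    ... | K , le = ℕ.<⇒≱ too-many (tough-cut G tough (cut-removing G ys K p) several)
      where
      too-many : 2 * length (ys ++ Cut.removed K) < length (Cut.comps K)
      too-many = ℕ.<-≤-trans (ℕ.≤-<-trans
        (ℕ.≤-reflexive (≡.trans (cong (2 *_) (List.length-++ ys)) (ℕ.*-distribˡ-+ 2 (length ys) _)))
        (ℕ.+-monoˡ-< (2 * length (Cut.removed K)) gt)) le
      several : 2 ≤ length (Cut.comps K)
      several = ℕ.≤-trans (ℕ.*-monoʳ-≤ 2 (ℕ.≤-trans ys≥1
        (ℕ.≤-trans (ℕ.m≤m+n _ _) (ℕ.≤-reflexive (≡.sym (List.length-++ ys)))))) (ℕ.<⇒≤ too-many)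

theorem3p2 : (n : ℕ) (G : Graph n) → 2 ≤ n → GraphConnected G → ¬ HasInducedP4 G
    → HasSpanningSBEP G ⇔ ToughnessAtLeastHalf G
theorem3p2 n G 2≤n conn free = mk⇔ forward backward
  where
  forward : HasSpanningSBEP G → ToughnessAtLeastHalf G
  forward _ S 1 _ (s≤s ())
  forward (H , H-WF , spanning , H⊑G , H-connected , blocks , two-blocks) S (suc (suc k)) (comp , inhabited , same) _ =
    subst (_≤ 2 * ∣ S ∣) (≡.sym (ℕ.*-identityˡ _))
      (components-bound {G = G} {H} H-WF spanning H⊑G H-connected blocks two-blocks S comp inhabited same)
  backward : ToughnessAtLeastHalf G → HasSpanningSBEP G
  backward tough = cotree-SBEP G 2≤n conn tough (cotree G (no-P4 G free) n (List.allFin n)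
    (subst (1 ≤_) (≡.sym len) (ℕ.<⇒≤ 2≤n)) (ℕ.≤-reflexive len)) refl
    where
    len : length (List.allFin n) ≡ n
    len = List.length-tabulate (λ i → i)
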